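{- Let $k\ge1$, $m\ge0$, and let $n_1,\dots,n_k\ge2$ be pairwise coprime integers. Let $p(x)=\sum_{i=0}^{m+k-1}a_i(1-x)^i\in\mathbb{Q}[x]$ be a polynomial having no root in common with $1-x^{n_j}$ for $1\le j\le k$. For $i\ne j$ let $a_i^{(j)},b_i^{(j)}$ be positive integers with $a_i^{(j)}n_i-b_i^{(j)}n_j=1$, and put $a_j^{(j)}=1$. Then $$\frac{p(x)}{(1-x)^m}\prod_{j=1}^{k}\frac{1}{1-x^{n_j}}=\sum_{j=0}^{m+k-2}\frac{c_j}{(1-x)^{m+k-j}}+\sum_{j=1}^{k}\frac{h_j(x)}{1-x^{n_j}},$$ where $$c_j=\frac{1}{n_1\cdots n_k}\sum_{\substack{i,i_1,\dots,i_k\ge0\\ i+i_1+\cdots+i_k=j}}a_i\,f^{(n_1)}_{i_1}(1)\cdots f^{(n_k)}_{i_k}(1)$$ and $$h_j(x)=\Big(p(x)\,f^{(n_j)}_{m+k-1}(x)\sum_{i_1=0}^{a_1^{(j)}-1}\cdots\sum_{i_k=0}^{a_k^{(j)}-1}x^{(i_1n_1+\cdots+i_kn_k)\%n_j}\Big)\ \mathrm{rem}\ \Psi_{n_j}(x).$$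
   Context: For $n\ge2$, $\Psi_n(x)=\frac{1-x^n}{1-x}=1+x+\cdots+x^{n-1}$. For $f,p\in\mathbb{Q}[x]$ with $p\neq0$, $f\ \mathrm{rem}\ p$ denotes the remainder of $f$ on Euclidean division by $p$. For integers, $a\%n$ denotes the remainder in $\{0,\dots,n-1\}$ of $a$ modulo $n$. For $n\ge 2$ and $j\ge0$, $f^{(n)}_j(x)=\big(-\tfrac1n x\Psi_n'(x)\big)^j\ \mathrm{rem}\ \Psi_n(x)$, with $f^{(n)}_0(x)=1$. The superscripted integers $a_i^{(j)}$ are unrelated to the coefficients $a_i$ of $p$. -}

module Defs where

open import Algebra.Apartness.Bundles using (HeytingField; HeytingCommutativeRing)
open import Algebra.Bundles using (RawRing; RawSemiring; CommutativeRing)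
import Algebra.Definitions.RawSemiring as RawSemiringDefs
open import Algebra.Morphism.Structures using (module RingMorphisms)
open import Data.Fin.Base using (Fin; zero; suc; toℕ)
open import Data.Integer.Base using (+_)
open import Data.List.Base using (List; []; _∷_; map; foldr)
open import Data.Nat.Base as ℕ using (ℕ; zero; suc; _∸_; NonTrivial; nonTrivial⇒nonZero; s≤s)
import Data.Nat.DivMod as ℕ
import Data.Nat.Properties as ℕ
open import Data.Nat.Induction using (<-rec)
open import Data.Product.Base using (_×_; _,_)
open import Data.Rational.Base as ℚ using (ℚ; 0ℚ; 1ℚ)
import Data.Rational.Properties as ℚ
open import Data.Sum.Base using (_⊎_; inj₁; inj₂; [_,_]′)
import Data.Vec.Functional as Vector
open Vector using (Vector)
open import Function.Base using (_∘_)
open import Level using (0ℓ)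
open import Relation.Binary.PropositionalEquality
open import Relation.Nullary using (¬_; Dec; yes; no; contradiction)

-- Finite sums and products

module Sums {c ℓ} (R : RawSemiring c ℓ) where
  open RawSemiring R public using (Carrier; _+_; _*_; 0#; 1#)
  open RawSemiringDefs R public using (sum; product; _^_)

  -- ∑_{0 ≤ i₁ < b₁} ⋯ ∑_{0 ≤ iₖ < bₖ} g (i₁ , … , iₖ)
  sumBelow : ∀ {k} → Vector ℕ k → (Vector ℕ k → Carrier) → Carrier
  sumBelow {zero}  b g = g Vector.[]
  sumBelow {suc k} b g =
    sum {b zero} λ i → sumBelow (Vector.tail b) λ is → g (toℕ i Vector.∷ is)

  -- ∑ g (i₁ , … , iₖ) over all i₁, …, iₖ ≥ 0 with i₁ + ⋯ + iₖ = j
  sumTotal : ∀ {k} → ℕ → (Vector ℕ k → Carrier) → Carrier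
  sumTotal {zero}  zero    g = g Vector.[]
  sumTotal {zero}  (suc j) g = 0#
  sumTotal {suc k} j       g =
    sum {suc j} λ i → sumTotal (j ∸ toℕ i) λ is → g (toℕ i Vector.∷ is)

module Sumsℕ = Sums ℕ.+-*-rawSemiring
module Sumsℚ = Sums (RawRing.rawSemiring ℚ.+-*-rawRing)

-- The polynomial ring ℚ[x]

-- A list holds the coefficients from the constant term upwards.  Trailing zeros
-- are allowed, so equality of polynomials is _≈ₚ_ rather than _≡_.
ℚ[x] : Set
ℚ[x] = List ℚ

coeff : ℚ[x] → ℕ → ℚ
coeff []      i       = 0ℚ
coeff (a ∷ p) zero    = a
coeff (a ∷ p) (suc i) = coeff p i

infix 4 _≈ₚ_
_≈ₚ_ : ℚ[x] → ℚ[x] → Set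
p ≈ₚ q = ∀ i → coeff p i ≡ coeff q i

const : ℚ → ℚ[x]
const a = a ∷ []

0ₚ 1ₚ X : ℚ[x]
0ₚ = []
1ₚ = const 1ℚ
X  = 0ℚ ∷ 1ℚ ∷ []

infix  8 -ₚ_
infixl 7 _*ₚ_
infixl 6 _+ₚ_ _-ₚ_

_+ₚ_ : ℚ[x] → ℚ[x] → ℚ[x]
[]      +ₚ q       = q
(a ∷ p) +ₚ []      = a ∷ p
(a ∷ p) +ₚ (b ∷ q) = (a ℚ.+ b) ∷ (p +ₚ q)

-ₚ_ : ℚ[x] → ℚ[x]
-ₚ_ = map (λ a → ℚ.- a)

_-ₚ_ : ℚ[x] → ℚ[x] → ℚ[x]
p -ₚ q = p +ₚ -ₚ q

_*ₚ_ : ℚ[x] → ℚ[x] → ℚ[x]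
[]      *ₚ q = []
(a ∷ p) *ₚ q = map (a ℚ.*_) q +ₚ (0ℚ ∷ (p *ₚ q))

ℚ[x]-rawRing : RawRing 0ℓ 0ℓ
ℚ[x]-rawRing = record
  { Carrier = ℚ[x] ; _≈_ = _≈ₚ_
  ; _+_ = _+ₚ_ ; _*_ = _*ₚ_ ; -_ = -ₚ_ ; 0# = 0ₚ ; 1# = 1ₚ }

module Sumsₚ = Sums (RawRing.rawSemiring ℚ[x]-rawRing)
open Sumsₚ public using () renaming (_^_ to _^ₚ_; sum to sumₚ)

-- (a + x p)′ = p + x p′
deriv : ℚ[x] → ℚ[x]
deriv []      = []
deriv (a ∷ p) = p +ₚ (0ℚ ∷ deriv p)

-- The value at z of the polynomial with coefficients transported along φ
evalVia : (K : RawRing 0ℓ 0ℓ) → (ℚ → RawRing.Carrier K) →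
          ℚ[x] → RawRing.Carrier K → RawRing.Carrier K
evalVia K φ p z = foldr (λ a v → φ a + z * v) 0# p
  where open RawRing K

eval : ℚ[x] → ℚ → ℚ
eval = evalVia ℚ.+-*-rawRing (λ a → a)

-- Roots are taken in arbitrary field extensions φ : ℚ → K, not just in ℚ.
NoCommonRoot : ℚ[x] → ℚ[x] → Set₁
NoCommonRoot p q =
  (K : HeytingField 0ℓ 0ℓ 0ℓ) →
  let module K = HeytingField K
      rawK     = CommutativeRing.rawRing
                   (HeytingCommutativeRing.commutativeRing K.heytingCommutativeRing)
  in
  (φ : ℚ → K.Carrier) →
  RingMorphisms.IsRingHomomorphism ℚ.+-*-rawRing rawK φ →
  (z : K.Carrier) →
  ¬ (evalVia rawK φ p z K.≈ K.0# × evalVia rawK φ q z K.≈ K.0#)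

-- Non-zero polynomials

record NonZeroₚ (p : ℚ[x]) : Set where
  constructor nonZeroₚ
  field ≉0 : ¬ (p ≈ₚ 0ₚ)

≈0? : ∀ p → Dec (p ≈ₚ 0ₚ)
≈0? [] = yes λ _ → refl
≈0? (a ∷ p) with a ℚ.≟ 0ℚ | ≈0? p
... | yes a≡0 | yes p≈0 = yes λ { zero → a≡0 ; (suc i) → p≈0 i }
... | no  a≢0 | _       = no λ eq → a≢0 (eq 0)
... | _       | no  p≉0 = no λ eq → p≉0 (eq ∘ suc)

coeff-+ : ∀ p q i → coeff (p +ₚ q) i ≡ coeff p i ℚ.+ coeff q i
coeff-+ []      q       i       = sym (ℚ.+-identityˡ _)
coeff-+ (a ∷ p) []      i       = sym (ℚ.+-identityʳ _)
coeff-+ (a ∷ p) (b ∷ q) zero    = refl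
coeff-+ (a ∷ p) (b ∷ q) (suc i) = coeff-+ p q i

coeff-map-* : ∀ a p i → coeff (map (a ℚ.*_) p) i ≡ a ℚ.* coeff p i
coeff-map-* a []      i       = sym (ℚ.*-zeroʳ a)
coeff-map-* a (b ∷ p) zero    = refl
coeff-map-* a (b ∷ p) (suc i) = coeff-map-* a p i

coeff-* : ∀ a p q i →
          coeff ((a ∷ p) *ₚ q) i ≡ a ℚ.* coeff q i ℚ.+ coeff (0ℚ ∷ (p *ₚ q)) i
coeff-* a p q i = trans (coeff-+ (map (a ℚ.*_) q) _ i)
                        (cong (ℚ._+ _) (coeff-map-* a q i))

coeff-*-vanish : ∀ p q i → (∀ l → l ℕ.≤ i → coeff q l ≡ 0ℚ) → coeff (p *ₚ q) i ≡ 0ℚ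
coeff-*-vanish []      q i q≤i = refl
coeff-*-vanish (a ∷ p) q i q≤i = begin
  coeff ((a ∷ p) *ₚ q) i                          ≡⟨ coeff-* a p q i ⟩
  a ℚ.* coeff q i ℚ.+ coeff (0ℚ ∷ (p *ₚ q)) i     ≡⟨ cong₂ ℚ._+_ (cong (a ℚ.*_) (q≤i i ℕ.≤-refl)) (rest i q≤i) ⟩
  a ℚ.* 0ℚ ℚ.+ 0ℚ                                 ≡⟨ ℚ.+-identityʳ _ ⟩
  a ℚ.* 0ℚ                                        ≡⟨ ℚ.*-zeroʳ a ⟩
  0ℚ                                              ∎
  where
  open ≡-Reasoning
  rest : ∀ i → (∀ l → l ℕ.≤ i → coeff q l ≡ 0ℚ) → coeff (0ℚ ∷ (p *ₚ q)) i ≡ 0ℚ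
  rest zero    _   = refl
  rest (suc i) q≤i = coeff-*-vanish p q i λ l l≤i → q≤i l (ℕ.m≤n⇒m≤1+n l≤i)

*ₚ-cancel-0 : ∀ p q → p *ₚ q ≈ₚ 0ₚ → p ≈ₚ 0ₚ ⊎ q ≈ₚ 0ₚ
*ₚ-cancel-0 []      q pq≈0 = inj₁ λ _ → refl
*ₚ-cancel-0 (a ∷ p) q pq≈0 with a ℚ.≟ 0ℚ
... | yes refl = [ (λ p≈0 → inj₁ λ { zero → refl ; (suc i) → p≈0 i }) , inj₂ ]′
                   (*ₚ-cancel-0 p q λ i → trans (sym (shift i)) (pq≈0 (suc i)))
  where
  shift : ∀ i → coeff ((0ℚ ∷ p) *ₚ q) (suc i) ≡ coeff (p *ₚ q) i
  shift i = trans (coeff-* 0ℚ p q (suc i))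
                  (trans (cong (ℚ._+ coeff (p *ₚ q) i) (ℚ.*-zeroˡ (coeff q (suc i)))) (ℚ.+-identityˡ _))
... | no a≢0 = inj₂ (<-rec _ step)
  where
  open ≡-Reasoning
  rest : ∀ i → (∀ {l} → l ℕ.< i → coeff q l ≡ 0ℚ) → coeff (0ℚ ∷ (p *ₚ q)) i ≡ 0ℚ
  rest zero    _   = refl
  rest (suc i) q<i = coeff-*-vanish p q i λ l l≤i → q<i (s≤s l≤i)

  instance
    a-nonZero : ℚ.NonZero a
    a-nonZero = ℚ.≢-nonZero a≢0

  step : ∀ i → (∀ {l} → l ℕ.< i → coeff q l ≡ 0ℚ) → coeff q i ≡ 0ℚ
  step i q<i = begin
    coeff q i                       ≡⟨ ℚ.*-identityˡ _ ⟨
    1ℚ ℚ.* coeff q i                ≡⟨ cong (ℚ._* coeff q i) (ℚ.*-inverseˡ a) ⟨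
    ℚ.1/ a ℚ.* a ℚ.* coeff q i      ≡⟨ ℚ.*-assoc (ℚ.1/ a) a _ ⟩
    ℚ.1/ a ℚ.* (a ℚ.* coeff q i)    ≡⟨ cong (ℚ.1/ a ℚ.*_) aqᵢ≡0 ⟩
    ℚ.1/ a ℚ.* 0ℚ                   ≡⟨ ℚ.*-zeroʳ (ℚ.1/ a) ⟩
    0ℚ                              ∎
    where
    aqᵢ≡0 : a ℚ.* coeff q i ≡ 0ℚ
    aqᵢ≡0 = begin
      a ℚ.* coeff q i                               ≡⟨ ℚ.+-identityʳ _ ⟨
      a ℚ.* coeff q i ℚ.+ 0ℚ                        ≡⟨ cong (a ℚ.* coeff q i ℚ.+_) (rest i q<i) ⟨
      a ℚ.* coeff q i ℚ.+ coeff (0ℚ ∷ (p *ₚ q)) i   ≡⟨ coeff-* a p q i ⟨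
      coeff ((a ∷ p) *ₚ q) i                        ≡⟨ pq≈0 i ⟩
      0ℚ                                            ∎

nonZero-head : ∀ p → coeff p 0 ≢ 0ℚ → NonZeroₚ p
nonZero-head p p₀≢0 = nonZeroₚ λ p≈0 → p₀≢0 (p≈0 0)

1ₚ-nonZero : NonZeroₚ 1ₚ
1ₚ-nonZero = nonZero-head 1ₚ λ ()

*ₚ-nonZero : ∀ p q → NonZeroₚ p → NonZeroₚ q → NonZeroₚ (p *ₚ q)
*ₚ-nonZero p q (nonZeroₚ p≉0) (nonZeroₚ q≉0) =
  nonZeroₚ λ pq≈0 → [ p≉0 , q≉0 ]′ (*ₚ-cancel-0 p q pq≈0)

^ₚ-nonZero : ∀ p → NonZeroₚ p → ∀ e → NonZeroₚ (p ^ₚ e)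
^ₚ-nonZero p p≉0 zero    = 1ₚ-nonZero
^ₚ-nonZero p p≉0 (suc e) = *ₚ-nonZero p (p ^ₚ e) p≉0 (^ₚ-nonZero p p≉0 e)

-- Euclidean division

-- The degree of the zero polynomial is set to 0.
degree : ℚ[x] → ℕ
degree []      = 0
degree (a ∷ p) with ≈0? p
... | yes _ = 0
... | no  _ = suc (degree p)

leading : ℚ[x] → ℚ
leading p = coeff p (degree p)

leading≢0 : ∀ p → NonZeroₚ p → leading p ≢ 0ℚ
leading≢0 []      (nonZeroₚ p≉0) _ = p≉0 λ _ → refl
leading≢0 (a ∷ p) (nonZeroₚ p≉0) eq with ≈0? p
... | yes p≈0  = p≉0 λ { zero → eq ; (suc i) → p≈0 i }
... | no  p≉0′ = leading≢0 p (nonZeroₚ p≉0′) eq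

-- If r is the remainder of f, then a + x f has the same remainder as s = a + x r,
-- whose degree is at most d = degree p; subtracting the multiple of p that
-- cancels the coefficient of x^d in s leaves a polynomial of degree < d
-- (the zero polynomial when d = 0).
infixl 7 _rem_∵_
_rem_∵_ : ℚ[x] → (p : ℚ[x]) → NonZeroₚ p → ℚ[x]
[]      rem p ∵ p≉0 = 0ₚ
(a ∷ f) rem p ∵ p≉0 = s -ₚ const (coeff s (degree p) ℚ.÷ leading p) *ₚ p
  where
  s : ℚ[x]
  s = a ∷ (f rem p ∵ p≉0)
  instance
    leading-nonZero : ℚ.NonZero (leading p)
    leading-nonZero = ℚ.≢-nonZero (leading≢0 p p≉0)

-- The field of rational functions ℚ(x)

record ℚ⟨x⟩ : Set where
  constructor frac
  field
    num den     : ℚ[x]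
    den-nonZero : NonZeroₚ den
open ℚ⟨x⟩

infixl 7 _/ₚ_∵_
_/ₚ_∵_ : (p q : ℚ[x]) → NonZeroₚ q → ℚ⟨x⟩
p /ₚ q ∵ q≉0 = frac p q q≉0

infix 4 _≈ᵣ_
_≈ᵣ_ : ℚ⟨x⟩ → ℚ⟨x⟩ → Set
f ≈ᵣ g = num f *ₚ den g ≈ₚ num g *ₚ den f

infixl 7 _*ᵣ_
infixl 6 _+ᵣ_

_+ᵣ_ : ℚ⟨x⟩ → ℚ⟨x⟩ → ℚ⟨x⟩
f +ᵣ g = frac (num f *ₚ den g +ₚ num g *ₚ den f) (den f *ₚ den g)
              (*ₚ-nonZero (den f) (den g) (den-nonZero f) (den-nonZero g))

_*ᵣ_ : ℚ⟨x⟩ → ℚ⟨x⟩ → ℚ⟨x⟩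
f *ᵣ g = frac (num f *ₚ num g) (den f *ₚ den g)
              (*ₚ-nonZero (den f) (den g) (den-nonZero f) (den-nonZero g))

0ᵣ 1ᵣ : ℚ⟨x⟩
0ᵣ = frac 0ₚ 1ₚ 1ₚ-nonZero
1ᵣ = frac 1ₚ 1ₚ 1ₚ-nonZero

ℚ⟨x⟩-rawSemiring : RawSemiring 0ℓ 0ℓ
ℚ⟨x⟩-rawSemiring = record
  { Carrier = ℚ⟨x⟩ ; _≈_ = _≈ᵣ_ ; _+_ = _+ᵣ_ ; _*_ = _*ᵣ_ ; 0# = 0ᵣ ; 1# = 1ᵣ }

module Sumsᵣ = Sums ℚ⟨x⟩-rawSemiring
open Sumsᵣ public using () renaming (sum to sumᵣ; product to productᵣ)

-- The polynomials of the theorem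

Ψ : ℕ → ℚ[x]
Ψ n = sumₚ {n} λ i → X ^ₚ toℕ i

coeff-X^suc : ∀ e → coeff (X ^ₚ suc e) 0 ≡ 0ℚ
coeff-X^suc e = trans (coeff-* 0ℚ (1ℚ ∷ []) (X ^ₚ e) 0)
  (trans (ℚ.+-identityʳ _) (ℚ.*-zeroˡ (coeff (X ^ₚ e) 0)))

coeff-sum-0 : ∀ n (g : Vector ℚ[x] n) → (∀ i → coeff (g i) 0 ≡ 0ℚ) → coeff (sumₚ g) 0 ≡ 0ℚ
coeff-sum-0 zero    g g₀≡0 = refl
coeff-sum-0 (suc n) g g₀≡0 = trans (coeff-+ (g zero) _ 0)
  (cong₂ ℚ._+_ (g₀≡0 zero) (coeff-sum-0 n (g ∘ suc) (g₀≡0 ∘ suc)))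

Ψ-nonZero : ∀ n → ⦃ NonTrivial n ⦄ → NonZeroₚ (Ψ n)
Ψ-nonZero (suc n) = nonZero-head (Ψ (suc n)) λ Ψ₀≡0 →
  contradiction (trans (sym Ψ₀≡1) Ψ₀≡0) λ ()
  where
  Ψ₀≡1 : coeff (Ψ (suc n)) 0 ≡ 1ℚ
  Ψ₀≡1 = trans (coeff-+ 1ₚ (sumₚ {n} λ i → X ^ₚ suc (toℕ i)) 0)
    (cong (1ℚ ℚ.+_) (coeff-sum-0 n _ λ i → coeff-X^suc (toℕ i)))

1-X^-nonZero : ∀ n → ⦃ NonTrivial n ⦄ → NonZeroₚ (1ₚ -ₚ X ^ₚ n)
1-X^-nonZero (suc n) = nonZero-head (1ₚ -ₚ X ^ₚ suc n) λ eq →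
  contradiction (trans (sym head≡1) eq) λ ()
  where
  coeff-neg : ∀ p → coeff p 0 ≡ 0ℚ → coeff (-ₚ p) 0 ≡ 0ℚ
  coeff-neg []      eq = refl
  coeff-neg (a ∷ p) eq = cong (λ a → ℚ.- a) eq
  head≡1 : coeff (1ₚ -ₚ X ^ₚ suc n) 0 ≡ 1ℚ
  head≡1 = trans (coeff-+ 1ₚ (-ₚ X ^ₚ suc n) 0)
    (cong (1ℚ ℚ.+_) (coeff-neg (X ^ₚ suc n) (coeff-X^suc n)))

[1-X]^-nonZero : ∀ e → NonZeroₚ ((1ₚ -ₚ X) ^ₚ e)
[1-X]^-nonZero = ^ₚ-nonZero (1ₚ -ₚ X) (nonZero-head (1ₚ -ₚ X) λ ())

f : (n : ℕ) → ⦃ NonTrivial n ⦄ → ℕ → ℚ[x]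
f n j = ((const (ℚ.- (+ 1 ℚ./ n)) *ₚ X *ₚ deriv (Ψ n)) ^ₚ j) rem Ψ n ∵ Ψ-nonZero n
  where
  instance
    n≢0 : ℕ.NonZero n
    n≢0 = nonTrivial⇒nonZero n

product-nonZero : ∀ {k} (n : Vector ℕ k) → (∀ j → ℕ.NonZero (n j)) →
                  ℕ.NonZero (Sumsℕ.product n)
product-nonZero {zero}  n n≢0 = _
product-nonZero {suc k} n n≢0 = ℕ.m*n≢0 (n zero) _ ⦃ n≢0 zero ⦄
  ⦃ product-nonZero (n ∘ suc) (n≢0 ∘ suc) ⦄

-- The tuple summed over is (i , i₁ , … , iₖ).
c : ∀ {k} (n : Vector ℕ k) → ⦃ ∀ {j} → NonTrivial (n j) ⦄ → (ℕ → ℚ) → ℕ → ℚ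
c n a j = (+ 1 ℚ./ Sumsℕ.product n) ℚ.* Sumsℚ.sumTotal j λ is →
  a (Vector.head is) ℚ.* Sumsℚ.product λ l → eval (f (n l) (Vector.tail is l)) 1ℚ
  where
  instance
    product≢0 : ℕ.NonZero (Sumsℕ.product n)
    product≢0 = product-nonZero n λ j → nonTrivial⇒nonZero (n j)

-- The bounds a₁^{(j)}, …, aₖ^{(j)} are A j 1, …, A j k.
h : ∀ {k} → ℕ → (n : Vector ℕ k) → ⦃ ∀ {j} → NonTrivial (n j) ⦄ →
    ℚ[x] → (Fin k → Fin k → ℕ) → Fin k → ℚ[x]
h {k} m n p A j =
  (p *ₚ f (n j) (m ℕ.+ k ∸ 1) *ₚ
   Sumsₚ.sumBelow (A j) λ is → X ^ₚ (Sumsℕ.sum (λ l → is l ℕ.* n l) ℕ.% n j))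
  rem Ψ (n j) ∵ Ψ-nonZero (n j)
  where
  instance
    nⱼ≢0 : ℕ.NonZero (n j)
    nⱼ≢0 = nonTrivial⇒nonZero (n j)

{-# OPTIONS --safe #-}

-- Put t = 1 - x, N = m + k - 1, Ψⱼ = Ψ_{nⱼ}, P = ∏ⱼ Ψⱼ and Pⱼ = ∏_{i≠j} Ψᵢ.  Over the common
-- denominator t^(m+k) P the claim is the polynomial identity
--   p = (∑_{j<N} cⱼ tʲ) P + t^N ∑ⱼ hⱼ Pⱼ.
-- Both sides have degree less than N + deg P, so it suffices to compare them modulo t^N and
-- modulo every Ψⱼ; these moduli are pairwise comaximal.
--
-- The derivative of t Ψₙ = 1 - xⁿ shows that -(1/n) x Ψₙ′ is inverse to t modulo Ψₙ.  Hence fᵢ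
-- is the representative of t^(-i) of degree < n - 1, and comparing degrees and values at 1 gives
-- n fᵢ = n t fᵢ₊₁ + fᵢ(1) Ψₙ, so that
--   n = n f_N t^N + Ψₙ ∑_{i<N} fᵢ(1) tⁱ.
-- Modulo t^N this makes the numbers fᵢ(1) the coefficients of n / Ψₙ in powers of t, and the cⱼ
-- those of p / P.  Modulo Ψⱼ, a n_i = 1 + b n_j gives
--   (∑_{l<a} x^(l n_i)) Ψᵢ = Ψ_{a n_i} = 1 + x Ψ_{b n_j} ≡ 1,
-- so the multiple sum in hⱼ is inverse to Pⱼ, and hⱼ Pⱼ t^N ≡ p.

module Submission where

open import Algebra.Bundles using (CommutativeRing; RawRing)
open import Algebra.Morphism.Structures using (module RingMorphisms)
import Algebra.Properties.AbelianGroup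
import Algebra.Properties.CommutativeMonoid.Sum
import Algebra.Properties.CommutativeSemigroup
import Algebra.Properties.CommutativeSemiring.Exp
import Algebra.Properties.Group
import Algebra.Properties.Ring
import Algebra.Properties.Semiring.Mult
import Algebra.Properties.Semiring.Sum
import Algebra.Solver.Ring.NaturalCoefficients.Default
open import Data.Fin.Base using (Fin; zero; suc; toℕ; punchIn; punchOut)
import Data.Fin.Properties as Fin
open import Data.Integer.Base as ℤ using (1ℤ)
import Data.Integer.Properties as ℤ
open import Data.Integer.Tactic.RingSolver using (solve-∀)
open import Data.List.Base using ([]; _∷_; map)
open import Data.Nat.Base as ℕ using (ℕ; zero; suc; _∸_; NonTrivial; nonTrivial⇒nonZero; s≤s; z≤n)
open import Data.Nat.Coprimality using (Coprime)
import Data.Nat.DivMod as ℕ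
import Data.Nat.Properties as ℕ
open import Data.Product.Base using (_,_)
open import Data.Rational.Base as ℚ using (ℚ; 0ℚ; 1ℚ)
import Data.Rational.Properties as ℚ
import Data.Rational.Unnormalised.Base as ℚᵘ
import Data.Rational.Unnormalised.Properties as ℚᵘ
open import Data.Sum.Base using (inj₁; inj₂; [_,_]′)
import Data.Vec.Functional as Vector
open Vector using (Vector; removeAt)
open import Data.Vec.Functional.Properties using (removeAt-punchOut)
open import Function.Base using (_∘_; id)
open import Level using (0ℓ; _⊔_)
open import Relation.Binary.PropositionalEquality as ≡ using (_≡_; _≢_)
open import Relation.Nullary using (yes; no; contradiction)
open import Defs using (module Sums; module Sumsℕ)

-- Congruences and truncated power series

-- The polar sum stops at order 2: a simple pole at 1 has no term of its own, since each h_j / (1 -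
-- x^(n_j)) = h_j / (t Ψⱼ) already allows one. This is where N = m + k - 1 comes from. Over t^(m+k)
-- P such a term keeps t^N in its numerator, so modulo t^N only c_0, ..., c_(N-1) are visible. The
-- last term a_N t^N of p disappears there as well; it is recovered because deg P ≥ 1 puts p below
-- the degree of the total modulus. Comaximality is always witnessed by an explicit inverse. Modulo
-- t^N the inverse of Ψₙ is 1/n times the truncated series with coefficients fᵢ(1); modulo Ψᵢ the
-- inverse of Ψⱼ is a geometric sum supplied by the Bézout relation. The congruences hold in any
-- commutative ring R with a homomorphism ι from a ring of coefficients in which the n_j are
-- invertible, and they are proved in that generality. Polynomials as coefficient lists enter only
-- where degrees, derivatives or values at 1 are involved.

module Ring {c ℓ} (R : CommutativeRing c ℓ) where
  open CommutativeRing R hiding (zero)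
  open Sums (RawRing.rawSemiring rawRing) using (product)
  open Algebra.Solver.Ring.NaturalCoefficients.Default commutativeSemiring
    using (solve; _:=_; _:+_; _:*_; con)
  open import Relation.Binary.Reasoning.Setoid setoid
  private module * = Algebra.Properties.CommutativeMonoid.Sum *-commutativeMonoid

  infix 4 _≋_[mod_]
  -- The quotient is kept as data because its degree is bounded later; this is how congruences of
  -- polynomials turn into equations.
  record _≋_[mod_] (a b p : Carrier) : Set (c ⊔ ℓ) where
    constructor modulo
    field
      quotient : Carrier
      equality : a ≈ b + quotient * p

  ≈⇒≋ : ∀ {a b p} → a ≈ b → a ≋ b [mod p ]
  ≈⇒≋ {a} {b} {p} a≈b = modulo 0# (begin
    a            ≈⟨ a≈b ⟩
    b            ≈⟨ +-identityʳ b ⟨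
    b + 0#       ≈⟨ +-congˡ (zeroˡ p) ⟨
    b + 0# * p   ∎)

  ≋-sym : ∀ {a b p} → a ≋ b [mod p ] → b ≋ a [mod p ]
  ≋-sym {a} {b} {p} (modulo q a≈) = modulo (- q) (begin
    b                          ≈⟨ +-identityʳ b ⟨
    -- The solver works in a commutative semiring and treats `- q` as an atom, so cancellation has
    -- to enter by hand, as `0#` rewritten to `q + - q`.
    b + 0#                     ≈⟨ +-congˡ (zeroˡ p) ⟨
    b + 0# * p                 ≈⟨ +-congˡ (*-congʳ (-‿inverseʳ q)) ⟨
    b + (q + - q) * p          ≈⟨ solve 4 (λ b q q′ p → b :+ (q :+ q′) :* p := (b :+ q :* p) :+ q′ :* p) refl b q (- q) p ⟩
    (b + q * p) + - q * p      ≈⟨ +-congʳ a≈ ⟨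
    a + - q * p                ∎)

  ≋-trans : ∀ {a b d p} → a ≋ b [mod p ] → b ≋ d [mod p ] → a ≋ d [mod p ]
  ≋-trans {a} {b} {d} {p} (modulo q a≈) (modulo r b≈) = modulo (r + q) (begin
    a                      ≈⟨ a≈ ⟩
    b + q * p              ≈⟨ +-congʳ b≈ ⟩
    (d + r * p) + q * p    ≈⟨ solve 4 (λ d r q p → (d :+ r :* p) :+ q :* p := d :+ (r :+ q) :* p) refl d r q p ⟩
    d + (r + q) * p        ∎)

  ≋-+-cong : ∀ {a b d e p} → a ≋ b [mod p ] → d ≋ e [mod p ] → a + d ≋ b + e [mod p ]
  ≋-+-cong {a} {b} {d} {e} {p} (modulo q a≈) (modulo r d≈) = modulo (q + r) (begin
    a + d                          ≈⟨ +-cong a≈ d≈ ⟩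
    (b + q * p) + (e + r * p)      ≈⟨ solve 5 (λ b q e r p → (b :+ q :* p) :+ (e :+ r :* p) := (b :+ e) :+ (q :+ r) :* p) refl b q e r p ⟩
    (b + e) + (q + r) * p          ∎)

  ≋-*-cong : ∀ {a b d e p} → a ≋ b [mod p ] → d ≋ e [mod p ] → a * d ≋ b * e [mod p ]
  ≋-*-cong {a} {b} {d} {e} {p} (modulo q a≈) (modulo r d≈) = modulo (q * e + (b * r + q * r * p)) (begin
    a * d                          ≈⟨ *-cong a≈ d≈ ⟩
    (b + q * p) * (e + r * p)      ≈⟨ solve 5 (λ b q e r p → (b :+ q :* p) :* (e :+ r :* p) := b :* e :+ (q :* e :+ (b :* r :+ q :* r :* p)) :* p) refl b q e r p ⟩
    b * e + (q * e + (b * r + q * r * p)) * p ∎)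

  ≋-‿cong : ∀ {a b p} → a ≋ b [mod p ] → - a ≋ - b [mod p ]
  ≋-‿cong {a} {b} {p} (modulo q a≈) = modulo (- q) (begin
    - a                  ≈⟨ -‿cong a≈ ⟩
    - (b + q * p)        ≈⟨ ⁻¹-∙-comm b (q * p) ⟨
    - b + - (q * p)      ≈⟨ +-congˡ (-‿distribˡ-* q p) ⟩
    - b + - q * p        ∎)
    where
    open Algebra.Properties.AbelianGroup +-abelianGroup using (⁻¹-∙-comm)
    open Algebra.Properties.Ring ring using (-‿distribˡ-*)

  -- The quotient ring on the same carrier, with only the equality changed: the generic results on
  -- sums and products, and setoid reasoning, then apply to congruences.
  R/⟨_⟩ : Carrier → CommutativeRing c (c ⊔ ℓ)
  R/⟨ p ⟩ = record
    { Carrier = Carrier ; _≈_ = _≋_[mod p ]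
    ; _+_ = _+_ ; _*_ = _*_ ; -_ = -_ ; 0# = 0# ; 1# = 1#
    ; isCommutativeRing = record
      { isRing = record
        { +-isAbelianGroup = record
          { isGroup = record
            { isMonoid = record
              { isSemigroup = record
                { isMagma = record
                  { isEquivalence = record { refl = ≈⇒≋ refl ; sym = ≋-sym ; trans = ≋-trans }
                  ; ∙-cong = ≋-+-cong }
                ; assoc = λ a b d → ≈⇒≋ (+-assoc a b d) }
              ; identity = (λ a → ≈⇒≋ (+-identityˡ a)) , (λ a → ≈⇒≋ (+-identityʳ a)) }
            ; inverse = (λ a → ≈⇒≋ (-‿inverseˡ a)) , (λ a → ≈⇒≋ (-‿inverseʳ a))
            ; ⁻¹-cong = ≋-‿cong }
          ; comm = λ a b → ≈⇒≋ (+-comm a b) }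
        ; *-cong = ≋-*-cong
        ; *-assoc = λ a b d → ≈⇒≋ (*-assoc a b d)
        ; *-identity = (λ a → ≈⇒≋ (*-identityˡ a)) , (λ a → ≈⇒≋ (*-identityʳ a))
        ; distrib = (λ a b d → ≈⇒≋ (distribˡ a b d)) , (λ a b d → ≈⇒≋ (distribʳ a b d)) }
      ; *-comm = λ a b → ≈⇒≋ (*-comm a b) } }

  q*p≋0 : ∀ q p → q * p ≋ 0# [mod p ]
  q*p≋0 q p = modulo q (sym (+-identityˡ (q * p)))

  -- Base case of the inductions whose modulus starts as an empty product or as `t ^ 0`.
  a≋b-mod-1 : ∀ a b → a ≋ b [mod 1# ]
  a≋b-mod-1 a b = modulo (- b + a) (begin
    a                        ≈⟨ +-identityˡ a ⟨
    0# + a                   ≈⟨ +-congʳ (-‿inverseʳ b) ⟨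
    (b + - b) + a            ≈⟨ +-assoc b (- b) a ⟩
    b + (- b + a)            ≈⟨ +-congˡ (*-identityʳ (- b + a)) ⟨
    b + (- b + a) * 1#       ∎)

  -- Raises the modulus from t^N to t^(N+1) in the induction for products of series.
  ≋-scale : ∀ {a b p} d → a ≋ b [mod p ] → d * a ≋ d * b [mod d * p ]
  ≋-scale {a} {b} {p} d (modulo q a≈) = modulo q (begin
    d * a                ≈⟨ *-congˡ a≈ ⟩
    d * (b + q * p)      ≈⟨ solve 4 (λ d b q p → d :* (b :+ q :* p) := d :* b :+ q :* (d :* p)) refl d b q p ⟩
    d * b + q * (d * p)  ∎)

  factor-≋0 : ∀ {k} (g : Vector Carrier k) l → product g ≋ 0# [mod g l ]
  factor-≋0 {suc k} g l = ≋-trans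
    (≈⇒≋ (trans (*.sum-remove {i = l} g) (*-comm (g l) _)))
    (q*p≋0 (product (removeAt g l)) (g l))

  removed-factor-≋0 : ∀ {k} (g : Vector Carrier (suc k)) {i j} → i ≢ j →
                      product (removeAt g i) ≋ 0# [mod g j ]
  removed-factor-≋0 g {i} {j} i≢j =
    ≡.subst (product (removeAt g i) ≋ 0# [mod_]) (removeAt-punchOut g i≢j)
            (factor-≋0 (removeAt g i) (punchOut i≢j))

  product-≋ : ∀ {k p} {g h : Vector Carrier k} → (∀ l → g l ≋ h l [mod p ]) →
              product g ≋ product h [mod p ]
  product-≋ {p = p} = *′.sum-cong-≋
    where module *′ = Algebra.Properties.CommutativeMonoid.Sum (CommutativeRing.*-commutativeMonoid R/⟨ p ⟩)

  product-*-≋1 : ∀ {k p} (g h : Vector Carrier k) → (∀ l → g l * h l ≋ 1# [mod p ]) →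
                 product g * product h ≋ 1# [mod p ]
  product-*-≋1 {k} g h gh≋1 = ≋-trans (≈⇒≋ (sym (*.∑-distrib-+ g h)))
    (≋-trans (product-≋ gh≋1) (≈⇒≋ (*.sum-replicate-zero k)))

  -- The condition aR + bR = R, put asymmetrically as invertibility of b modulo a, which passes to
  -- products of such b.
  record Comaximal (a b : Carrier) : Set (c ⊔ ℓ) where
    constructor comaximal
    field
      inverse   : Carrier
      inverse-* : inverse * b ≋ 1# [mod a ]

  Comaximal-product : ∀ {k a} (g : Vector Carrier k) → (∀ l → Comaximal a (g l)) →
                      Comaximal a (product g)
  Comaximal-product g co = comaximal
    (product (Comaximal.inverse ∘ co))
    (product-*-≋1 (Comaximal.inverse ∘ co) g (Comaximal.inverse-* ∘ co))

  -- Let x - y = q a = r b and u b = 1 + v a. Then q a = q a (u b - v a) = q u a b - (r b) v a = (q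
  -- u - r v) a b, which gives the quotient.
  ≋-mod-* : ∀ {x y a b} → Comaximal a b →
            x ≋ y [mod a ] → x ≋ y [mod b ] → x ≋ y [mod a * b ]
  ≋-mod-* {x} {y} {a} {b} (comaximal u (modulo v ub≈)) (modulo q x≈₁) (modulo r x≈₂) =
    modulo (q * u + - (r * v)) (begin
      x                                       ≈⟨ x≈₁ ⟩
      y + q * a                               ≈⟨ +-congˡ qa≈ ⟩
      y + (q * u + - (r * v)) * (a * b)       ∎)
    where
    open Algebra.Properties.Group +-group using (∙-cancelˡ)
    qa≈rb : q * a ≈ r * b
    qa≈rb = ∙-cancelˡ y (q * a) (r * b) (trans (sym x≈₁) x≈₂)
    qa+rvab≈quab : q * a + r * v * (a * b) ≈ q * u * (a * b)
    qa+rvab≈quab = begin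
      q * a + r * v * (a * b)    ≈⟨ solve 5 (λ q a r v b → q :* a :+ r :* v :* (a :* b) := q :* a :+ (r :* b) :* (v :* a)) refl q a r v b ⟩
      q * a + (r * b) * (v * a)  ≈⟨ +-congˡ (*-congʳ qa≈rb) ⟨
      q * a + (q * a) * (v * a)  ≈⟨ solve 3 (λ q a v → q :* a :+ (q :* a) :* (v :* a) := q :* a :* (con 1 :+ v :* a)) refl q a v ⟩
      q * a * (1# + v * a)       ≈⟨ *-congˡ ub≈ ⟨
      q * a * (u * b)            ≈⟨ solve 4 (λ q a u b → q :* a :* (u :* b) := q :* u :* (a :* b)) refl q a u b ⟩
      q * u * (a * b)            ∎
    qa≈ : q * a ≈ (q * u + - (r * v)) * (a * b)
    qa≈ = begin
      q * a                                                ≈⟨ +-identityʳ _ ⟨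
      q * a + 0#                                           ≈⟨ +-congˡ (zeroˡ (a * b)) ⟨
      q * a + 0# * (a * b)                                 ≈⟨ +-congˡ (*-congʳ (-‿inverseʳ (r * v))) ⟨
      q * a + (r * v + - (r * v)) * (a * b)                ≈⟨ solve 4 (λ d w w′ e → d :+ (w :+ w′) :* e := (d :+ w :* e) :+ w′ :* e) refl (q * a) (r * v) (- (r * v)) (a * b) ⟩
      (q * a + r * v * (a * b)) + - (r * v) * (a * b)      ≈⟨ +-congʳ qa+rvab≈quab ⟩
      q * u * (a * b) + - (r * v) * (a * b)                ≈⟨ distribʳ (a * b) (q * u) (- (r * v)) ⟨
      (q * u + - (r * v)) * (a * b)                        ∎

  ≋-mod-product : ∀ {k x y} (g : Vector Carrier k) →
                  (∀ {i j} → i ≢ j → Comaximal (g i) (g j)) →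
                  (∀ l → x ≋ y [mod g l ]) → x ≋ y [mod product g ]
  ≋-mod-product {zero}  {x} {y} g co x≋y = a≋b-mod-1 x y
  ≋-mod-product {suc k} g co x≋y = ≋-mod-*
    (Comaximal-product (g ∘ suc) λ l → co λ ())
    (x≋y zero)
    (≋-mod-product (g ∘ suc) (λ i≢j → co (i≢j ∘ Fin.suc-injective)) (x≋y ∘ suc))

-- Multiple sums modulo an element

module Residues {c ℓ} (R : CommutativeRing c ℓ) (p : CommutativeRing.Carrier R) where
  open CommutativeRing R hiding (zero)
  open Ring R
  open CommutativeRing R/⟨ p ⟩ public
    using ()
    renaming (setoid to ≋-setoid; semiring to ≋-semiring
             ; +-congˡ to ≋-+-congˡ
             ; *-congˡ to ≋-*-congˡ; *-congʳ to ≋-*-congʳ)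
  open Sums (RawRing.rawSemiring rawRing) using (sum; product; sumBelow)
  open Algebra.Properties.Semiring.Sum semiring using (*-distribˡ-sum; *-distribʳ-sum)
  open Algebra.Properties.Semiring.Sum ≋-semiring public using () renaming (sum-cong-≋ to sum-≋)
  open import Relation.Binary.Reasoning.Setoid ≋-setoid

  -- The distributive law, by induction on the number of indices. `d` collects the factors of the
  -- indices already fixed by outer sums, so the hypothesis on `G` has the same shape at every
  -- depth. A congruence is asked of `G`, since in `h` the exponents are reduced modulo n_j.
  sumBelow-product : ∀ {k} (b : Vector ℕ k) d (G : Vector ℕ k → Carrier)
                     (g : Fin k → ℕ → Carrier) →
                     (∀ is → G is ≋ d * product (λ l → g l (is l)) [mod p ]) →
                     sumBelow b G ≋ d * product (λ l → sum {b l} (λ i → g l (toℕ i))) [mod p ]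
  sumBelow-product {zero}      b d G g G≋ = G≋ Vector.[]
  sumBelow-product {suc k} b d G g G≋ = begin
    sum {b zero} (λ i → sumBelow (b ∘ suc) λ is → G (toℕ i Vector.∷ is))
      ≈⟨ sum-≋ {b zero} (λ i → sumBelow-product (b ∘ suc) (d * g zero (toℕ i)) _ (g ∘ suc) λ is →
           ≋-trans (G≋ (toℕ i Vector.∷ is)) (≈⇒≋ (sym (*-assoc d _ _)))) ⟩
    sum {b zero} (λ i → d * g zero (toℕ i) * Π)
      ≈⟨ ≈⇒≋ (*-distribʳ-sum {b zero} Π (λ i → d * g zero (toℕ i))) ⟨
    sum {b zero} (λ i → d * g zero (toℕ i)) * Π
      ≈⟨ ≈⇒≋ (*-congʳ (*-distribˡ-sum {b zero} d (λ i → g zero (toℕ i)))) ⟨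
    d * sum {b zero} (λ i → g zero (toℕ i)) * Π
      ≈⟨ ≈⇒≋ (*-assoc d _ Π) ⟩
    d * (sum {b zero} (λ i → g zero (toℕ i)) * Π) ∎
    where
    Π = product (λ l → sum {b (suc l)} (λ i → g (suc l) (toℕ i)))

-- Geometric sums

module Geometric {c ℓ} (R : CommutativeRing c ℓ) where
  open CommutativeRing R hiding (zero)
  open Ring R
  open Sums (RawRing.rawSemiring rawRing) using (sum; product; _^_; sumBelow)
  open Algebra.Properties.Semiring.Sum semiring using (*-distribˡ-sum)
  open Algebra.Properties.CommutativeSemiring.Exp commutativeSemiring using (^-homo-*; ^-assocʳ)
  open Algebra.Solver.Ring.NaturalCoefficients.Default commutativeSemiring
    using (solve; _:=_; _:+_; _:*_; con)
  open import Relation.Binary.Reasoning.Setoid setoid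

  -- Over ℚ[x], `geo X n` unfolds to `Ψ n`, while `geo (X ^ n) a` is one factor of the multiple sum
  -- in `h`; hence the general base `y`.
  geo : Carrier → ℕ → Carrier
  geo y n = sum {n} λ i → y ^ toℕ i

  geo-suc : ∀ y n → geo y (suc n) ≈ 1# + y * geo y n
  geo-suc y n = +-congˡ (sym (*-distribˡ-sum {n} y (λ i → y ^ toℕ i)))

  geo-+ : ∀ y a b → geo y (a ℕ.+ b) ≈ geo y a + y ^ a * geo y b
  geo-+ y zero    b = sym (trans (+-identityˡ _) (*-identityˡ (geo y b)))
  geo-+ y (suc a) b = begin
    geo y (suc (a ℕ.+ b))                       ≈⟨ geo-suc y (a ℕ.+ b) ⟩
    1# + y * geo y (a ℕ.+ b)                    ≈⟨ +-congˡ (*-congˡ (geo-+ y a b)) ⟩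
    1# + y * (geo y a + y ^ a * geo y b)        ≈⟨ solve 4 (λ y g w h → con 1 :+ y :* (g :+ w :* h) := (con 1 :+ y :* g) :+ y :* w :* h) refl y (geo y a) (y ^ a) (geo y b) ⟩
    (1# + y * geo y a) + y * y ^ a * geo y b    ≈⟨ +-congʳ (geo-suc y a) ⟨
    geo y (suc a) + y ^ suc a * geo y b         ∎

  -- Each exponent below a n is l n + r for exactly one l < a and one r < n; the induction on a
  -- splits off one block of n exponents at a time.
  geo-* : ∀ y a n → geo (y ^ n) a * geo y n ≈ geo y (a ℕ.* n)
  geo-* y zero    n = zeroˡ (geo y n)
  geo-* y (suc a) n = begin
    geo (y ^ n) (suc a) * geo y n                       ≈⟨ *-congʳ (geo-suc (y ^ n) a) ⟩
    (1# + y ^ n * geo (y ^ n) a) * geo y n              ≈⟨ solve 3 (λ w g h → (con 1 :+ w :* g) :* h := h :+ w :* (g :* h)) refl (y ^ n) (geo (y ^ n) a) (geo y n) ⟩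
    geo y n + y ^ n * (geo (y ^ n) a * geo y n)         ≈⟨ +-congˡ (*-congˡ (geo-* y a n)) ⟩
    geo y n + y ^ n * geo y (a ℕ.* n)                   ≈⟨ geo-+ y n (a ℕ.* n) ⟨
    geo y (n ℕ.+ a ℕ.* n)                               ∎

  -- The identity (1 - y)(1 + ... + y^(n-1)) = 1 - y^n, written without subtraction so that the
  -- semiring solver applies.
  geo-telescopes : ∀ {t y} → t + y ≈ 1# → ∀ n → t * geo y n + y ^ n ≈ 1#
  geo-telescopes {t} {y} t+y≈1 zero    = trans (+-congʳ (zeroʳ t)) (+-identityˡ 1#)
  geo-telescopes {t} {y} t+y≈1 (suc n) = begin
    t * geo y (suc n) + y * y ^ n            ≈⟨ +-congʳ (*-congˡ (geo-suc y n)) ⟩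
    t * (1# + y * geo y n) + y * y ^ n       ≈⟨ solve 4 (λ t y g w → t :* (con 1 :+ y :* g) :+ y :* w := t :+ y :* (t :* g :+ w)) refl t y (geo y n) (y ^ n) ⟩
    t + y * (t * geo y n + y ^ n)            ≈⟨ +-congˡ (*-congˡ (geo-telescopes t+y≈1 n)) ⟩
    t + y * 1#                               ≈⟨ +-congˡ (*-identityʳ y) ⟩
    t + y                                    ≈⟨ t+y≈1 ⟩
    1#                                       ∎

  geo-inverse : ∀ y {a b m n} → a ℕ.* m ≡ suc (b ℕ.* n) →
                geo (y ^ m) a * geo y m ≋ 1# [mod geo y n ]
  geo-inverse y {a} {b} {m} {n} am≡1+bn = modulo (y * geo (y ^ n) b) (begin
    geo (y ^ m) a * geo y m                    ≈⟨ geo-* y a m ⟩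
    geo y (a ℕ.* m)                            ≡⟨ ≡.cong (geo y) am≡1+bn ⟩
    geo y (suc (b ℕ.* n))                      ≈⟨ geo-suc y (b ℕ.* n) ⟩
    1# + y * geo y (b ℕ.* n)                   ≈⟨ +-congˡ (*-congˡ (geo-* y b n)) ⟨
    1# + y * (geo (y ^ n) b * geo y n)         ≈⟨ +-congˡ (*-assoc y _ _) ⟨
    1# + y * geo (y ^ n) b * geo y n           ∎)

  module _ {t x : Carrier} (t+x≈1 : t + x ≈ 1#) where

    x^n≋1 : ∀ n → x ^ n ≋ 1# [mod geo x n ]
    x^n≋1 n = ≋-sym (modulo t (trans (sym (geo-telescopes t+x≈1 n)) (+-comm _ _)))

    x^[a*n]≋1 : ∀ a n → x ^ (a ℕ.* n) ≋ 1# [mod geo x n ]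
    x^[a*n]≋1 zero    n = ≈⇒≋ refl
    x^[a*n]≋1 (suc a) n = ≋-trans (≈⇒≋ (^-homo-* x n (a ℕ.* n)))
      (≋-trans (≋-*-cong (x^n≋1 n) (x^[a*n]≋1 a n)) (≈⇒≋ (*-identityˡ 1#)))

    x^[s%n]≋x^s : ∀ s n .⦃ _ : ℕ.NonZero n ⦄ → x ^ (s ℕ.% n) ≋ x ^ s [mod geo x n ]
    x^[s%n]≋x^s s n = ≋-sym (≋-trans
      (≈⇒≋ (trans (reflexive (≡.cong (x ^_) (ℕ.m≡m%n+[m/n]*n s n))) (^-homo-* x (s ℕ.% n) _)))
      (≋-trans (≋-*-cong (≈⇒≋ refl) (x^[a*n]≋1 (s ℕ./ n) n)) (≈⇒≋ (*-identityʳ _))))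

    x^-sum : ∀ {k} (n is : Vector ℕ k) →
             x ^ Sumsℕ.sum (λ l → is l ℕ.* n l) ≈ product (λ l → (x ^ n l) ^ is l)
    x^-sum {zero}  n is = refl
    x^-sum {suc k} n is = trans (^-homo-* x (is zero ℕ.* n zero) _)
      (*-cong (trans (reflexive (≡.cong (x ^_) (ℕ.*-comm (is zero) (n zero))))
                     (sym (^-assocʳ x (n zero) (is zero))))
              (x^-sum (n ∘ suc) (is ∘ suc)))

    -- Modulo Ψₘ the power x^m is 1, so reducing the exponent changes nothing; the power of a sum
    -- then splits into one factor per index.
    sumBelow-x^ : ∀ {k} (n b : Vector ℕ k) m .⦃ _ : ℕ.NonZero m ⦄ →
      sumBelow b (λ is → x ^ (Sumsℕ.sum (λ l → is l ℕ.* n l) ℕ.% m))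
        ≋ product (λ l → geo (x ^ n l) (b l)) [mod geo x m ]
    sumBelow-x^ n b m = ≋-trans
      (Residues.sumBelow-product R (geo x m) b 1# _ (λ l i → (x ^ n l) ^ i) λ is →
        ≋-trans (x^[s%n]≋x^s _ m) (≈⇒≋ (trans (x^-sum n is) (sym (*-identityˡ _)))))
      (≈⇒≋ (*-identityˡ _))

-- Power series in t modulo t^N

module Truncation {c₁ ℓ₁ c₂ ℓ₂} (S : CommutativeRing c₁ ℓ₁) (R : CommutativeRing c₂ ℓ₂)
  {ι : CommutativeRing.Carrier S → CommutativeRing.Carrier R}
  (ι-isHomomorphism : RingMorphisms.IsRingHomomorphism (CommutativeRing.rawRing S) (CommutativeRing.rawRing R) ι)
  (t : CommutativeRing.Carrier R) where

  open CommutativeRing R hiding (zero)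
  open RingMorphisms.IsRingHomomorphism ι-isHomomorphism
    using (+-homo; *-homo; 0#-homo; 1#-homo; ⟦⟧-cong)
  private module S = CommutativeRing S
  open Ring R
  open Sums (RawRing.rawSemiring rawRing) using (sum; product; _^_)
  open Sums (RawRing.rawSemiring S.rawRing) using ()
    renaming (sum to sumₛ; product to productₛ; sumTotal to sumTotalₛ)
  open Algebra.Properties.Semiring.Sum S.semiring using ()
    renaming (sum-cong-≋ to sumₛ-cong; *-distribˡ-sum to *-distribˡ-sumₛ)
  open Algebra.Properties.Semiring.Sum semiring using (sum-cong-≋; *-distribˡ-sum)
  open Algebra.Solver.Ring.NaturalCoefficients.Default commutativeSemiring
    using (solve; _:=_; _:+_; _:*_; con)
  open import Relation.Binary.Reasoning.Setoid setoid

  -- Stands for the series ∑ u_j t^j modulo t^N. Coefficients are functions on all of ℕ, so that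
  -- `convolve` and `sumTotal` need not mention N.
  truncate : ℕ → (ℕ → S.Carrier) → Carrier
  truncate N u = sum {N} λ j → ι (u (toℕ j)) * t ^ toℕ j

  truncate-cong : ∀ N {u v : ℕ → S.Carrier} → (∀ j → u j S.≈ v j) → truncate N u ≈ truncate N v
  truncate-cong N u≈v = sum-cong-≋ {N} λ j → *-congʳ (⟦⟧-cong (u≈v (toℕ j)))

  truncate-suc : ∀ N u → truncate (suc N) u ≈ ι (u 0) + t * truncate N (u ∘ suc)
  truncate-suc N u = +-cong (*-identityʳ _)
    (trans (sum-cong-≋ {N} λ j →
              solve 3 (λ a t w → a :* (t :* w) := t :* (a :* w)) refl (ι (u (suc (toℕ j)))) t (t ^ toℕ j))
           (sym (*-distribˡ-sum {N} t _)))

  truncate-last : ∀ N u → truncate (suc N) u ≈ truncate N u + ι (u N) * t ^ N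
  truncate-last zero    u = +-comm _ _
  truncate-last (suc N) u = begin
    truncate (2 ℕ.+ N) u                                             ≈⟨ truncate-suc (suc N) u ⟩
    ι (u 0) + t * truncate (suc N) (u ∘ suc)                         ≈⟨ +-congˡ (*-congˡ (truncate-last N (u ∘ suc))) ⟩
    ι (u 0) + t * (truncate N (u ∘ suc) + ι (u (suc N)) * t ^ N)     ≈⟨ solve 5 (λ a t b d w → a :+ t :* (b :+ d :* w) := (a :+ t :* b) :+ d :* (t :* w)) refl (ι (u 0)) t _ (ι (u (suc N))) (t ^ N) ⟩
    (ι (u 0) + t * truncate N (u ∘ suc)) + ι (u (suc N)) * t ^ suc N ≈⟨ +-congʳ (truncate-suc N u) ⟨
    truncate (suc N) u + ι (u (suc N)) * t ^ suc N                   ∎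

  truncate-+ : ∀ N u v → truncate N (λ j → u j S.+ v j) ≈ truncate N u + truncate N v
  truncate-+ zero    u v = sym (+-identityˡ 0#)
  truncate-+ (suc N) u v = begin
    truncate (suc N) (λ j → u j S.+ v j)                     ≈⟨ truncate-last N (λ j → u j S.+ v j) ⟩
    truncate N (λ j → u j S.+ v j) + ι (u N S.+ v N) * t ^ N ≈⟨ +-cong (truncate-+ N u v) (*-congʳ (+-homo (u N) (v N))) ⟩
    (truncate N u + truncate N v) + (ι (u N) + ι (v N)) * t ^ N
      ≈⟨ solve 5 (λ a b d e w → (a :+ b) :+ (d :+ e) :* w := (a :+ d :* w) :+ (b :+ e :* w)) refl _ _ (ι (u N)) (ι (v N)) (t ^ N) ⟩
    (truncate N u + ι (u N) * t ^ N) + (truncate N v + ι (v N) * t ^ N)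
      ≈⟨ +-cong (truncate-last N u) (truncate-last N v) ⟨
    truncate (suc N) u + truncate (suc N) v                  ∎

  truncate-* : ∀ N a u → truncate N (λ j → a S.* u j) ≈ ι a * truncate N u
  truncate-* N a u = trans
    (sum-cong-≋ {N} λ j → trans (*-congʳ (*-homo a _)) (*-assoc (ι a) _ _))
    (sym (*-distribˡ-sum {N} (ι a) _))

  convolve : (u v : ℕ → S.Carrier) → ℕ → S.Carrier
  convolve u v j = sumₛ {suc j} λ i → u (toℕ i) S.* v (j ∸ toℕ i)

  -- Splitting off u_0 gives u v = u_0 v + t (u⁺ v). The second term carries a factor t, so modulo
  -- t^(N+1) it is needed only modulo t^N; this is the induction hypothesis, and there v may be cut
  -- after N or N + 1 terms alike (`extend`).
  truncate-convolve : ∀ N u v →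
    truncate N (convolve u v) ≋ truncate N u * truncate N v [mod t ^ N ]
  truncate-convolve zero    u v = a≋b-mod-1 _ _
  truncate-convolve (suc N) u v = ≋-trans (≈⇒≋ split) (≋-trans
    (≋-+-cong (≈⇒≋ refl) (≋-scale t (≋-trans (truncate-convolve N u⁺ v) (≋-*-cong (≈⇒≋ refl) extend))))
    (≈⇒≋ join))
    where
    u⁺ v⁺ : ℕ → S.Carrier
    u⁺ = u ∘ suc
    v⁺ = v ∘ suc
    split : truncate (suc N) (convolve u v) ≈ ι (u 0) * truncate (suc N) v + t * truncate N (convolve u⁺ v)
    split = begin
      truncate (suc N) (convolve u v)
        ≈⟨ truncate-suc N (convolve u v) ⟩
      ι (u 0 S.* v 0 S.+ S.0#) + t * truncate N (λ j → u 0 S.* v⁺ j S.+ convolve u⁺ v j)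
        ≈⟨ +-cong (trans (⟦⟧-cong (S.+-identityʳ _)) (*-homo (u 0) (v 0)))
                  (*-congˡ (trans (truncate-+ N (λ j → u 0 S.* v⁺ j) (convolve u⁺ v)) (+-congʳ (truncate-* N (u 0) v⁺)))) ⟩
      ι (u 0) * ι (v 0) + t * (ι (u 0) * truncate N v⁺ + truncate N (convolve u⁺ v))
        ≈⟨ solve 5 (λ a b t d e → a :* b :+ t :* (a :* d :+ e) := a :* (b :+ t :* d) :+ t :* e) refl (ι (u 0)) (ι (v 0)) t _ _ ⟩
      ι (u 0) * (ι (v 0) + t * truncate N v⁺) + t * truncate N (convolve u⁺ v)
        ≈⟨ +-congʳ (*-congˡ (truncate-suc N v)) ⟨
      ι (u 0) * truncate (suc N) v + t * truncate N (convolve u⁺ v) ∎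
    extend : truncate N v ≋ truncate (suc N) v [mod t ^ N ]
    extend = ≋-sym (modulo (ι (v N)) (truncate-last N v))
    join : ι (u 0) * truncate (suc N) v + t * (truncate N u⁺ * truncate (suc N) v)
           ≈ truncate (suc N) u * truncate (suc N) v
    join = begin
      ι (u 0) * truncate (suc N) v + t * (truncate N u⁺ * truncate (suc N) v)
        ≈⟨ solve 4 (λ a b t d → a :* b :+ t :* (d :* b) := (a :+ t :* d) :* b) refl (ι (u 0)) _ t _ ⟩
      (ι (u 0) + t * truncate N u⁺) * truncate (suc N) v
        ≈⟨ *-congʳ (truncate-suc N u) ⟨
      truncate (suc N) u * truncate (suc N) v ∎

  sumTotal-* : ∀ {k} j a (g : Vector ℕ k → S.Carrier) →
               sumTotalₛ j (λ is → a S.* g is) S.≈ a S.* sumTotalₛ j g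
  sumTotal-* {zero}  zero    a g = S.refl
  sumTotal-* {zero}  (suc j) a g = S.sym (S.zeroʳ a)
  sumTotal-* {suc k} j       a g = S.trans
    (sumₛ-cong {suc j} λ i → sumTotal-* (j ∸ toℕ i) a λ is → g (toℕ i Vector.∷ is))
    (S.sym (*-distribˡ-sumₛ {suc j} a λ i → sumTotalₛ (j ∸ toℕ i) λ is → g (toℕ i Vector.∷ is)))

  -- `sumTotal` is an iterated Cauchy product: once the factor of the first index is pulled out, the
  -- sum over i₁ + ... + iₖ = j is the convolution of the first sequence with the sum over the
  -- remaining indices.
  truncate-sumTotal : ∀ {k} N (u : Fin k → ℕ → S.Carrier) →
    truncate N (λ j → sumTotalₛ j λ is → productₛ λ l → u l (is l))
      ≋ product (λ l → truncate N (u l)) [mod t ^ N ]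
  truncate-sumTotal {zero} zero    u = a≋b-mod-1 _ _
  truncate-sumTotal {zero} (suc N) u = ≈⇒≋ (begin
    truncate (suc N) δ                          ≈⟨ truncate-suc N δ ⟩
    -- With no indices left the series is 1. Its zero coefficients are written `0# * 0#` so that
    -- `truncate-*` pulls out `ι 0#`.
    ι S.1# + t * truncate N (λ _ → S.0#)        ≈⟨ +-cong 1#-homo (*-congˡ (truncate-cong N λ _ → S.sym (S.zeroˡ S.0#))) ⟩
    1# + t * truncate N (λ _ → S.0# S.* S.0#)   ≈⟨ +-congˡ (*-congˡ (trans (truncate-* N S.0# λ _ → S.0#) (trans (*-congʳ 0#-homo) (zeroˡ _)))) ⟩
    1# + t * 0#                                 ≈⟨ +-congˡ (zeroʳ t) ⟩
    1# + 0#                                     ≈⟨ +-identityʳ 1# ⟩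
    1#                                          ∎)
    where
    δ : ℕ → S.Carrier
    δ j = sumTotalₛ j λ is → productₛ λ l → u l (is l)
  truncate-sumTotal {suc k} N u = ≋-trans
    (≈⇒≋ (truncate-cong N λ j → sumₛ-cong {suc j} λ i → sumTotal-* (j ∸ toℕ i) (u zero (toℕ i)) λ is → productₛ λ l → u (suc l) (is l)))
    (≋-trans (truncate-convolve N (u zero) λ j → sumTotalₛ j λ is → productₛ λ l → u (suc l) (is l))
             (≋-*-cong (≈⇒≋ refl) (truncate-sumTotal N (u ∘ suc))))

-- Cross-multiplied fractions

module Fractions {c ℓ} (R : CommutativeRing c ℓ) where
  open CommutativeRing R hiding (zero)
  open Sums (RawRing.rawSemiring rawRing) using (product; _^_)
  open Algebra.Properties.CommutativeSemiring.Exp commutativeSemiring using (^-homo-*)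
  open Algebra.Solver.Ring.NaturalCoefficients.Default commutativeSemiring
    using (solve; _:=_; _:+_; _:*_; con)
  open import Relation.Binary.Reasoning.Setoid setoid

  -- Read a d = e b as a / b = e / d. Both summands are referred to the same d, so their numerators
  -- e and e′ simply add.
  +-fraction : ∀ a b e a′ b′ e′ d → a * d ≈ e * b → a′ * d ≈ e′ * b′ →
               (a * b′ + a′ * b) * d ≈ (e + e′) * (b * b′)
  +-fraction a b e a′ b′ e′ d ad≈eb a′d≈e′b′ = begin
    (a * b′ + a′ * b) * d            ≈⟨ solve 5 (λ a b a′ b′ d → (a :* b′ :+ a′ :* b) :* d := (a :* d) :* b′ :+ (a′ :* d) :* b) refl a b a′ b′ d ⟩
    (a * d) * b′ + (a′ * d) * b      ≈⟨ +-cong (*-congʳ ad≈eb) (*-congʳ a′d≈e′b′) ⟩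
    (e * b) * b′ + (e′ * b′) * b     ≈⟨ solve 4 (λ e b e′ b′ → (e :* b) :* b′ :+ (e′ :* b′) :* b := (e :+ e′) :* (b :* b′)) refl e b e′ b′ ⟩
    (e + e′) * (b * b′)              ∎

  *-fraction : ∀ a b e d a′ b′ e′ d′ → a * d ≈ e * b → a′ * d′ ≈ e′ * b′ →
               (a * a′) * (d * d′) ≈ (e * e′) * (b * b′)
  *-fraction a b e d a′ b′ e′ d′ ad≈eb a′d′≈e′b′ = begin
    (a * a′) * (d * d′)    ≈⟨ interchange a a′ d d′ ⟩
    (a * d) * (a′ * d′)    ≈⟨ *-cong ad≈eb a′d′≈e′b′ ⟩
    (e * b) * (e′ * b′)    ≈⟨ interchange e b e′ b′ ⟩
    (e * e′) * (b * b′)    ∎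
    where open Algebra.Properties.CommutativeSemigroup *-commutativeSemigroup using (interchange)

  -- Two fractions equal to e / d agree up to the factor d, which is cancelled later, in the domain
  -- ℚ[x].
  cross-multiply : ∀ a b a′ b′ e d → a * d ≈ e * b → a′ * d ≈ e * b′ → (a * b′) * d ≈ (a′ * b) * d
  cross-multiply a b a′ b′ e d ad≈eb a′d≈eb′ = begin
    (a * b′) * d     ≈⟨ solve 3 (λ a b d → (a :* b) :* d := (a :* d) :* b) refl a b′ d ⟩
    (a * d) * b′     ≈⟨ *-congʳ ad≈eb ⟩
    (e * b) * b′     ≈⟨ solve 3 (λ e b b′ → (e :* b) :* b′ := (e :* b′) :* b) refl e b b′ ⟩
    (e * b′) * b     ≈⟨ *-congʳ a′d≈eb′ ⟨
    (a′ * d) * b     ≈⟨ solve 3 (λ a b d → (a :* d) :* b := (a :* b) :* d) refl a′ b d ⟩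
    (a′ * b) * d     ∎

  product-replicate-* : ∀ t {k} (g : Vector Carrier k) → product (λ l → t * g l) ≈ t ^ k * product g
  product-replicate-* t {zero}  g = sym (*-identityˡ 1#)
  product-replicate-* t {suc k} g = begin
    (t * g zero) * product (λ l → t * g (suc l))    ≈⟨ *-congˡ (product-replicate-* t (g ∘ suc)) ⟩
    (t * g zero) * (t ^ k * product (g ∘ suc))      ≈⟨ solve 4 (λ t a w b → (t :* a) :* (w :* b) := (t :* w) :* (a :* b)) refl t (g zero) (t ^ k) (product (g ∘ suc)) ⟩
    t ^ suc k * product g                           ∎

  common-denominator : ∀ t m {k} (g : Vector Carrier k) →
                       t ^ m * product (λ l → t * g l) ≈ t ^ (m ℕ.+ k) * product g
  common-denominator t m {k} g = begin
    t ^ m * product (λ l → t * g l)    ≈⟨ *-congˡ (product-replicate-* t g) ⟩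
    t ^ m * (t ^ k * product g)        ≈⟨ *-assoc _ _ _ ⟨
    t ^ m * t ^ k * product g          ≈⟨ *-congʳ (^-homo-* t m k) ⟨
    t ^ (m ℕ.+ k) * product g          ∎

  pole-numerator : ∀ a t P {j M} → j ℕ.≤ M → a * (t ^ M * P) ≈ (a * t ^ j * P) * t ^ (M ∸ j)
  pole-numerator a t P {j} {M} j≤M = begin
    a * (t ^ M * P)                        ≡⟨ ≡.cong (λ M → a * (t ^ M * P)) (ℕ.m+[n∸m]≡n j≤M) ⟨
    a * (t ^ (j ℕ.+ (M ∸ j)) * P)          ≈⟨ *-congˡ (*-congʳ (^-homo-* t j (M ∸ j))) ⟩
    a * ((t ^ j * t ^ (M ∸ j)) * P)        ≈⟨ solve 4 (λ a v w P → a :* ((v :* w) :* P) := (a :* v :* P) :* w) refl a (t ^ j) (t ^ (M ∸ j)) P ⟩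
    (a * t ^ j * P) * t ^ (M ∸ j)          ∎

  -- With w = t^N: the denominator q = t ψ consumes a single t of t^(N+1), so t^N survives in the
  -- numerator and this part vanishes modulo t^N.
  cyclotomic-numerator : ∀ h t w P ψ P′ {q} → q ≈ t * ψ → P ≈ ψ * P′ →
                         h * (t * w * P) ≈ (w * (h * P′)) * q
  cyclotomic-numerator h t w P ψ P′ {q} q≈tψ P≈ψP′ = begin
    h * (t * w * P)              ≈⟨ *-congˡ (*-congˡ P≈ψP′) ⟩
    h * (t * w * (ψ * P′))       ≈⟨ solve 5 (λ h t w ψ P → h :* (t :* w :* (ψ :* P)) := (w :* (h :* P)) :* (t :* ψ)) refl h t w ψ P′ ⟩
    (w * (h * P′)) * (t * ψ)     ≈⟨ *-congˡ q≈tψ ⟨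
    (w * (h * P′)) * q           ∎

-- The inverse of t modulo Ψₙ

module InverseOfT {c ℓ} (R : CommutativeRing c ℓ) {t x : CommutativeRing.Carrier R}
  (t+x≈1 : CommutativeRing._≈_ R (CommutativeRing._+_ R t x) (CommutativeRing.1# R)) where
  open CommutativeRing R hiding (zero)
  open Ring R
  open Geometric R
  open Sums (RawRing.rawSemiring rawRing) using (_^_)
  open Algebra.Solver.Ring.NaturalCoefficients.Default commutativeSemiring
    using (solve; _:=_; _:+_; _:*_; con)

  -- `D n` stands for the derivative of Ψₙ and `ν n` for the number n in R. Only their recursions
  -- matter; `D-suc` is the product rule for Ψₙ₊₁ = 1 + x Ψₙ.
  module _ (D ν : ℕ → Carrier) (D₀≈0 : D 0 ≈ 0#) (ν₀≈0 : ν 0 ≈ 0#)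
    (D-suc : ∀ n → D (suc n) ≈ geo x n + x * D n) (ν-suc : ∀ n → ν (suc n) ≈ 1# + ν n) where

    -- This is x times the derivative of (1 - x) Ψₙ = 1 - xⁿ.
    derivative-identity : ∀ n → x * (t * D n) + ν n * x ^ n ≈ x * geo x n
    derivative-identity zero = begin
      x * (t * D 0) + ν 0 * 1#    ≈⟨ +-cong (*-congˡ (*-congˡ D₀≈0)) (*-congʳ ν₀≈0) ⟩
      x * (t * 0#) + 0# * 1#      ≈⟨ solve 2 (λ x t → x :* (t :* con 0) :+ con 0 :* con 1 := x :* con 0) refl x t ⟩
      x * 0#                      ∎
      where open import Relation.Binary.Reasoning.Setoid setoid
    derivative-identity (suc n) = begin
      x * (t * D (suc n)) + ν (suc n) * (x * x ^ n)
        ≈⟨ +-cong (*-congˡ (*-congˡ (D-suc n))) (*-congʳ (ν-suc n)) ⟩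
      x * (t * (geo x n + x * D n)) + (1# + ν n) * (x * x ^ n)
        ≈⟨ solve 6 (λ x t g d m w → x :* (t :* (g :+ x :* d)) :+ (con 1 :+ m) :* (x :* w)
                     := x :* ((t :* g :+ w) :+ (x :* (t :* d) :+ m :* w))) refl x t (geo x n) (D n) (ν n) (x ^ n) ⟩
      x * ((t * geo x n + x ^ n) + (x * (t * D n) + ν n * x ^ n))
        ≈⟨ *-congˡ (+-cong (geo-telescopes t+x≈1 n) (derivative-identity n)) ⟩
      x * (1# + x * geo x n)
        ≈⟨ *-congˡ (geo-suc x n) ⟨
      x * geo x (suc n) ∎
      where open import Relation.Binary.Reasoning.Setoid setoid

    -- Here κ = 1/n and κ′ = -1/n. Multiplied by κ′, `derivative-identity` becomes κ′ x t D = x^n +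
    -- κ′ x Ψₙ, and x^n is 1 modulo Ψₙ.
    t*g≋1 : ∀ {κ κ′} n → κ′ + κ ≈ 0# → κ * ν n ≈ 1# → t * (κ′ * x * D n) ≋ 1# [mod geo x n ]
    t*g≋1 {κ} {κ′} n κ′+κ≈0 κν≈1 = ≋-trans (modulo (κ′ * x) (begin
      t * (κ′ * x * D n)
        ≈⟨ solve 6 (λ t k x d m w → t :* (k :* x :* d) := k :* (x :* (t :* d)) :+ con 0 :* (m :* w)) refl t κ′ x (D n) (ν n) (x ^ n) ⟩
      -- The zero term becomes (κ′ + κ) ν x^n: its κ′ part completes the derivative identity, its κ
      -- part is x^n.
      κ′ * (x * (t * D n)) + 0# * (ν n * x ^ n)
        ≈⟨ +-congˡ (*-congʳ κ′+κ≈0) ⟨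
      κ′ * (x * (t * D n)) + (κ′ + κ) * (ν n * x ^ n)
        ≈⟨ solve 5 (λ k l d m w → k :* d :+ (k :+ l) :* (m :* w) := (l :* m) :* w :+ k :* (d :+ m :* w)) refl κ′ κ (x * (t * D n)) (ν n) (x ^ n) ⟩
      κ * ν n * x ^ n + κ′ * (x * (t * D n) + ν n * x ^ n)
        ≈⟨ +-cong (*-congʳ κν≈1) (*-congˡ (derivative-identity n)) ⟩
      1# * x ^ n + κ′ * (x * geo x n)
        ≈⟨ +-cong (*-identityˡ _) (sym (*-assoc κ′ x _)) ⟩
      x ^ n + κ′ * x * geo x n ∎))
      (x^n≋1 t+x≈1 n)
      where open import Relation.Binary.Reasoning.Setoid setoid

  t*power : ∀ {g ψ} → t * g ≋ 1# [mod ψ ] → ∀ i → t * g ^ suc i ≋ g ^ i [mod ψ ]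
  t*power {g} tg≋1 i = ≋-trans (≈⇒≋ (sym (*-assoc t g (g ^ i))))
    (≋-trans (≋-*-cong tg≋1 (≈⇒≋ refl)) (≈⇒≋ (*-identityˡ _)))

-- The numerator identity modulo t^N P

module PartialFractions {c₁ ℓ₁ c₂ ℓ₂} (S : CommutativeRing c₁ ℓ₁) (R : CommutativeRing c₂ ℓ₂)
  {ι : CommutativeRing.Carrier S → CommutativeRing.Carrier R}
  (ι-isHomomorphism : RingMorphisms.IsRingHomomorphism (CommutativeRing.rawRing S) (CommutativeRing.rawRing R) ι)
  (t x : CommutativeRing.Carrier R) where

  open CommutativeRing R hiding (zero)
  open RingMorphisms.IsRingHomomorphism ι-isHomomorphism using (*-homo; 1#-homo; ⟦⟧-cong)
  private module S = CommutativeRing S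
  open Ring R
  open Geometric R
  open Truncation S R ι-isHomomorphism t
  open Sums (RawRing.rawSemiring rawRing) using (sum; product; _^_)
  open Sums (RawRing.rawSemiring S.rawRing) using ()
    renaming (product to productₛ; sumTotal to sumTotalₛ)
  open Algebra.Properties.Semiring.Sum semiring using (sum-remove; sum-replicate-zero)
  open Algebra.Solver.Ring.NaturalCoefficients.Default commutativeSemiring
    using (solve; _:=_; _:+_; _:*_; con)
  private module * = Algebra.Properties.CommutativeMonoid.Sum *-commutativeMonoid

  ι-product : ∀ {k} (v : Vector S.Carrier k) → ι (productₛ v) ≈ product (ι ∘ v)
  ι-product {zero}  v = 1#-homo
  ι-product {suc k} v = trans (*-homo _ _) (*-congˡ (ι-product (v ∘ suc)))

  -- Unrolling φᵢ = t φᵢ₊₁ + (uᵢ / ν) ψ.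
  expansion : ∀ {ψ ν} (φ : ℕ → Carrier) (u : ℕ → S.Carrier) → φ 0 ≈ 1# →
              (∀ i → ι ν * φ i ≈ ι ν * (t * φ (suc i)) + ι (u i) * ψ) →
              ∀ N → ι ν ≈ ι ν * (φ N * t ^ N) + ψ * truncate N u
  expansion {ψ} {ν} φ u φ₀≈1 step zero = begin
    ι ν                                  ≈⟨ solve 2 (λ a b → a := a :* (con 1 :* con 1) :+ b :* con 0) refl (ι ν) ψ ⟩
    ι ν * (1# * 1#) + ψ * 0#             ≈⟨ +-congʳ (*-congˡ (*-congʳ φ₀≈1)) ⟨
    ι ν * (φ 0 * 1#) + ψ * 0#            ∎
    where open import Relation.Binary.Reasoning.Setoid setoid
  expansion {ψ} {ν} φ u φ₀≈1 step (suc N) = begin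
    ι ν
      ≈⟨ expansion φ u φ₀≈1 step N ⟩
    ι ν * (φ N * t ^ N) + ψ * truncate N u
      ≈⟨ solve 5 (λ a b w d e → a :* (b :* w) :+ d :* e := (a :* b) :* w :+ d :* e) refl (ι ν) (φ N) (t ^ N) ψ (truncate N u) ⟩
    ι ν * φ N * t ^ N + ψ * truncate N u
      ≈⟨ +-congʳ (*-congʳ (step N)) ⟩
    (ι ν * (t * φ (suc N)) + ι (u N) * ψ) * t ^ N + ψ * truncate N u
      ≈⟨ solve 7 (λ a t b v d w e → (a :* (t :* b) :+ v :* d) :* w :+ d :* e := a :* (b :* (t :* w)) :+ d :* (e :+ v :* w)) refl
           (ι ν) t (φ (suc N)) (ι (u N)) ψ (t ^ N) (truncate N u) ⟩
    ι ν * (φ (suc N) * t ^ suc N) + ψ * (truncate N u + ι (u N) * t ^ N)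
      ≈⟨ +-congˡ (*-congˡ (truncate-last N u)) ⟨
    ι ν * (φ (suc N) * t ^ suc N) + ψ * truncate (suc N) u ∎
    where open import Relation.Binary.Reasoning.Setoid setoid

  module _ {k} (n : Vector ℕ (suc k)) (N : ℕ) where

    private
      Ψ : Vector Carrier (suc k)
      Ψ l = geo x (n l)

    -- In the application `ν l` is n_l, `φ l` is f_N for n_l, and `u l i` is the value fᵢ(1) for
    -- n_l; `expand` is the outcome of `expansion`.
    module _
      (A B : Fin (suc k) → Fin (suc k) → ℕ)
      (An≡1+Bn : ∀ {i j} → i ≢ j → A j i ℕ.* n i ≡ suc (B j i ℕ.* n j))
      (A≡1 : ∀ j → A j j ≡ 1)
      (ν ν⁻¹ : Vector S.Carrier (suc k)) (ν⁻¹*ν≈1 : ∀ l → ν⁻¹ l S.* ν l S.≈ S.1#)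
      (φ : Vector Carrier (suc k)) (u : Fin (suc k) → ℕ → S.Carrier)
      (expand : ∀ l → ι (ν l) ≈ ι (ν l) * (φ l * t ^ N) + Ψ l * truncate N (u l))
      where

      ν⁻¹*-cancel : ∀ l y → ι (ν⁻¹ l) * (ι (ν l) * y) ≈ y
      ν⁻¹*-cancel l y = begin
        ι (ν⁻¹ l) * (ι (ν l) * y)    ≈⟨ *-assoc _ _ y ⟨
        ι (ν⁻¹ l) * ι (ν l) * y      ≈⟨ *-congʳ (trans (sym (*-homo _ _)) (trans (⟦⟧-cong (ν⁻¹*ν≈1 l)) 1#-homo)) ⟩
        1# * y                       ≈⟨ *-identityˡ y ⟩
        y                            ∎
        where open import Relation.Binary.Reasoning.Setoid setoid

      Ψ*truncate≋ν : ∀ l → truncate N (u l) * Ψ l ≋ ι (ν l) [mod t ^ N ]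
      Ψ*truncate≋ν l = ≋-sym (modulo (ι (ν l) * φ l) (trans (expand l)
        (solve 5 (λ a b w d e → a :* (b :* w) :+ d :* e := e :* d :+ a :* b :* w) refl (ι (ν l)) (φ l) (t ^ N) (Ψ l) _)))

      -- Modulo Ψ l, `expand` reads ν = ν φ t^N, and ν is a unit.
      φt^N≋1 : ∀ l → φ l * t ^ N ≋ 1# [mod Ψ l ]
      φt^N≋1 l = ≋-sym (≋-trans (≈⇒≋ (sym (ν⁻¹*-cancel l 1#)))
        (≋-trans (≋-*-cong (≈⇒≋ refl) (modulo (truncate N (u l))
                   (trans (*-identityʳ _) (trans (expand l) (+-congˡ (*-comm _ _))))))
                 (≈⇒≋ (ν⁻¹*-cancel l _))))

      -- The inverse of Ψ j modulo Ψ i comes from the Bézout relation A i j n_j = 1 + B i j n_i.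
      Ψ-comaximal : ∀ {i j} → i ≢ j → Comaximal (Ψ i) (Ψ j)
      Ψ-comaximal {i} {j} i≢j =
        comaximal (geo (x ^ n j) (A i j)) (geo-inverse x {A i j} {B i j} (An≡1+Bn (i≢j ∘ ≡.sym)))

      -- Each Ψ l is a unit modulo t^N because its product with the truncated series of `u l` is the
      -- unit ν l.
      t^N-comaximal : Comaximal (t ^ N) (product Ψ)
      t^N-comaximal = Comaximal-product Ψ λ l → comaximal (ι (ν⁻¹ l) * truncate N (u l)) (begin
        ι (ν⁻¹ l) * truncate N (u l) * Ψ l      ≈⟨ ≈⇒≋ (*-assoc _ _ _) ⟩
        ι (ν⁻¹ l) * (truncate N (u l) * Ψ l)    ≈⟨ ≋-*-congˡ (Ψ*truncate≋ν l) ⟩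
        ι (ν⁻¹ l) * ι (ν l)                     ≈⟨ ≈⇒≋ (*-congˡ (sym (*-identityʳ _))) ⟩
        ι (ν⁻¹ l) * (ι (ν l) * 1#)              ≈⟨ ≈⇒≋ (ν⁻¹*-cancel l 1#) ⟩
        1#                                      ∎)
        where
        open Residues R (t ^ N)
        open import Relation.Binary.Reasoning.Setoid ≋-setoid

      -- Each factor with l ≠ j inverts Ψ l. The choice A j j = 1 makes the factor at l = j equal to
      -- 1, so the product over all l inverts the product over l ≠ j.
      geo-product-inverse : ∀ j →
        product (λ l → geo (x ^ n l) (A j l)) * product (removeAt Ψ j) ≋ 1# [mod Ψ j ]
      geo-product-inverse j = ≋-trans
        (≈⇒≋ (*-congʳ (trans (*.sum-remove {i = j} (λ l → geo (x ^ n l) (A j l)))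
                             (trans (*-congʳ geo≈1) (*-identityˡ _)))))
        (product-*-≋1 (removeAt (λ l → geo (x ^ n l) (A j l)) j) (removeAt Ψ j) λ l →
          geo-inverse x {A j (punchIn j l)} {B j (punchIn j l)} (An≡1+Bn (Fin.punchInᵢ≢i j l)))
        where
        geo≈1 : geo (x ^ n j) (A j j) ≈ 1#
        geo≈1 = trans (reflexive (≡.cong (geo (x ^ n j)) (A≡1 j))) (+-identityʳ 1#)

      -- `μ` is 1/(n₁⋯nₖ). Here `h` is given only up to multiples of Ψ j; that it is the actual
      -- remainder matters later, for degrees.
      module _ (a : ℕ → S.Carrier) (μ : S.Carrier) (μν≈1 : μ S.* productₛ ν S.≈ S.1#)
        (c : ℕ → S.Carrier)
        (c≈ : ∀ j → c j S.≈ μ S.* sumTotalₛ j λ is → a (is zero) S.* productₛ λ l → u l (is (suc l)))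
        (p : Carrier) (p≋a : p ≋ truncate N a [mod t ^ N ])
        (h : Vector Carrier (suc k))
        (h≋ : ∀ j → h j ≋ p * φ j * product (λ l → geo (x ^ n l) (A j l)) [mod Ψ j ])
        where

        numerator-mod-t^N : truncate N c * product Ψ ≋ p [mod t ^ N ]
        numerator-mod-t^N = begin
          truncate N c * product Ψ
            ≈⟨ ≈⇒≋ (*-congʳ (trans (truncate-cong N c≈) (truncate-* N μ total))) ⟩
          ι μ * truncate N total * product Ψ
            -- The coefficients of p count as one more series in front, matching the index tuple (i,
            -- i₁, ..., iₖ) in `c`.
            ≈⟨ ≋-*-congʳ (≋-*-congˡ (truncate-sumTotal N (a Vector.∷ u))) ⟩
          ι μ * (truncate N a * product U) * product Ψ
            ≈⟨ ≈⇒≋ (solve 4 (λ m a b d → m :* (a :* b) :* d := a :* (m :* (b :* d))) refl (ι μ) (truncate N a) (product U) (product Ψ)) ⟩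
          truncate N a * (ι μ * (product U * product Ψ))
            ≈⟨ ≋-*-congˡ (≋-*-congˡ (≈⇒≋ (sym (*.∑-distrib-+ U Ψ)))) ⟩
          truncate N a * (ι μ * product (λ l → U l * Ψ l))
            ≈⟨ ≋-*-congˡ (≋-*-congˡ (product-≋ Ψ*truncate≋ν)) ⟩
          truncate N a * (ι μ * product (ι ∘ ν))
            ≈⟨ ≈⇒≋ (*-congˡ (trans (*-congˡ (sym (ι-product ν))) (sym (*-homo μ _)))) ⟩
          truncate N a * ι (μ S.* productₛ ν)
            ≈⟨ ≈⇒≋ (*-congˡ (trans (⟦⟧-cong μν≈1) 1#-homo)) ⟩
          truncate N a * 1#
            ≈⟨ ≈⇒≋ (*-identityʳ _) ⟩
          truncate N a
            ≈⟨ p≋a ⟨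
          p ∎
          where
          open Residues R (t ^ N)
          open import Relation.Binary.Reasoning.Setoid ≋-setoid
          U : Vector Carrier (suc k)
          U l = truncate N (u l)
          total : ℕ → S.Carrier
          total j = sumTotalₛ j λ is → a (is zero) S.* productₛ λ l → u l (is (suc l))

        numerator-mod-Ψ : ∀ j → t ^ N * (h j * product (removeAt Ψ j)) ≋ p [mod Ψ j ]
        numerator-mod-Ψ j = begin
          t ^ N * (h j * P)                ≈⟨ ≋-*-congˡ (≋-*-congʳ (h≋ j)) ⟩
          t ^ N * (p * φ j * G * P)        ≈⟨ ≈⇒≋ (solve 5 (λ w p f g q → w :* (p :* f :* g :* q) := p :* ((f :* w) :* (g :* q))) refl (t ^ N) p (φ j) G P) ⟩
          p * ((φ j * t ^ N) * (G * P))    ≈⟨ ≋-*-congˡ (≋-*-cong (φt^N≋1 j) (geo-product-inverse j)) ⟩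
          p * (1# * 1#)                    ≈⟨ ≈⇒≋ (solve 1 (λ p → p :* (con 1 :* con 1) := p) refl p) ⟩
          p                                ∎
          where
          open Residues R (Ψ j)
          open import Relation.Binary.Reasoning.Setoid ≋-setoid
          P G : Carrier
          P = product (removeAt Ψ j)
          G = product (λ l → geo (x ^ n l) (A j l))

        -- Removing any factor other than Ψ j leaves Ψ j in the product, so all other terms vanish.
        sum-mod-Ψ : ∀ j → sum (λ i → h i * product (removeAt Ψ i)) ≋ h j * product (removeAt Ψ j) [mod Ψ j ]
        sum-mod-Ψ j = begin
          sum H                        ≈⟨ ≈⇒≋ (sum-remove {i = j} H) ⟩
          H j + sum (removeAt H j)     ≈⟨ ≋-+-congˡ (sum-≋ {k} λ l → ≋-trans
                                            (≋-*-cong (≈⇒≋ refl) (removed-factor-≋0 Ψ (Fin.punchInᵢ≢i j l)))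
                                            (≈⇒≋ (zeroʳ _))) ⟩
          H j + sum {k} (λ _ → 0#)     ≈⟨ ≈⇒≋ (+-congˡ (sum-replicate-zero k)) ⟩
          H j + 0#                     ≈⟨ ≈⇒≋ (+-identityʳ _) ⟩
          H j                          ∎
          where
          open Residues R (Ψ j)
          open import Relation.Binary.Reasoning.Setoid ≋-setoid
          H : Vector Carrier (suc k)
          H i = h i * product (removeAt Ψ i)

        -- The two summands separate the moduli: the second is 0 modulo t^N, the first is 0 modulo
        -- every Ψ j.
        numerator-≋ : truncate N c * product Ψ + t ^ N * sum (λ j → h j * product (removeAt Ψ j))
                        ≋ p [mod t ^ N * product Ψ ]
        numerator-≋ = ≋-mod-* t^N-comaximal
          (≋-trans (≋-+-cong numerator-mod-t^N
                     (≋-trans (≈⇒≋ (*-comm _ _)) (q*p≋0 _ (t ^ N))))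
                   (≈⇒≋ (+-identityʳ p)))
          (≋-mod-product Ψ Ψ-comaximal λ j →
            ≋-trans (≋-+-cong
              (≋-trans (≋-*-cong (≈⇒≋ refl) (factor-≋0 Ψ j)) (≈⇒≋ (zeroʳ _)))
              (≋-trans (≋-*-cong (≈⇒≋ refl) (sum-mod-Ψ j)) (numerator-mod-Ψ j)))
            (≈⇒≋ (+-identityˡ p)))

-- The ring ℚ[x]

open import Data.Integer.Base using (+_)
open import Defs

module PolynomialRing where
  open ≡ using (refl; sym; trans; cong; cong₂)
  open ≡.≡-Reasoning
  open Algebra.Properties.CommutativeSemigroup (CommutativeRing.+-commutativeSemigroup ℚ.+-*-commutativeRing)
    using (interchange; x∙yz≈y∙xz)

  ∷-cong : ∀ a {p q} → p ≈ₚ q → (a ∷ p) ≈ₚ (a ∷ q)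
  ∷-cong a p≈q zero    = refl
  ∷-cong a p≈q (suc i) = p≈q i

  coeff-shift-+ : ∀ p q i → coeff (0ℚ ∷ (p +ₚ q)) i ≡ coeff (0ℚ ∷ p) i ℚ.+ coeff (0ℚ ∷ q) i
  coeff-shift-+ p q zero    = refl
  coeff-shift-+ p q (suc i) = coeff-+ p q i

  coeff-shift-map : ∀ a p i → coeff (0ℚ ∷ map (a ℚ.*_) p) i ≡ a ℚ.* coeff (0ℚ ∷ p) i
  coeff-shift-map a p zero    = sym (ℚ.*-zeroʳ a)
  coeff-shift-map a p (suc i) = coeff-map-* a p i

  coeff-neg : ∀ p i → coeff (-ₚ p) i ≡ ℚ.- coeff p i
  coeff-neg []      i       = refl
  coeff-neg (a ∷ p) zero    = refl
  coeff-neg (a ∷ p) (suc i) = coeff-neg p i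

  +ₚ-cong : ∀ p p′ q q′ → p ≈ₚ p′ → q ≈ₚ q′ → p +ₚ q ≈ₚ p′ +ₚ q′
  +ₚ-cong p p′ q q′ p≈ q≈ i = begin
    coeff (p +ₚ q) i             ≡⟨ coeff-+ p q i ⟩
    coeff p i ℚ.+ coeff q i      ≡⟨ cong₂ ℚ._+_ (p≈ i) (q≈ i) ⟩
    coeff p′ i ℚ.+ coeff q′ i    ≡⟨ coeff-+ p′ q′ i ⟨
    coeff (p′ +ₚ q′) i           ∎

  +ₚ-assoc : ∀ p q r → (p +ₚ q) +ₚ r ≈ₚ p +ₚ (q +ₚ r)
  +ₚ-assoc p q r i = begin
    coeff (p +ₚ q +ₚ r) i                          ≡⟨ coeff-+ (p +ₚ q) r i ⟩
    coeff (p +ₚ q) i ℚ.+ coeff r i                 ≡⟨ cong (ℚ._+ _) (coeff-+ p q i) ⟩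
    coeff p i ℚ.+ coeff q i ℚ.+ coeff r i          ≡⟨ ℚ.+-assoc (coeff p i) _ _ ⟩
    coeff p i ℚ.+ (coeff q i ℚ.+ coeff r i)        ≡⟨ cong (coeff p i ℚ.+_) (coeff-+ q r i) ⟨
    coeff p i ℚ.+ coeff (q +ₚ r) i                 ≡⟨ coeff-+ p (q +ₚ r) i ⟨
    coeff (p +ₚ (q +ₚ r)) i                        ∎

  +ₚ-comm : ∀ p q → p +ₚ q ≈ₚ q +ₚ p
  +ₚ-comm p q i = trans (coeff-+ p q i) (trans (ℚ.+-comm (coeff p i) (coeff q i)) (sym (coeff-+ q p i)))

  +ₚ-identityʳ : ∀ p → p +ₚ 0ₚ ≈ₚ p
  +ₚ-identityʳ p i = trans (coeff-+ p [] i) (ℚ.+-identityʳ _)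

  +ₚ-inverseʳ : ∀ p → p -ₚ p ≈ₚ 0ₚ
  +ₚ-inverseʳ p i = trans (coeff-+ p (-ₚ p) i)
    (trans (cong (coeff p i ℚ.+_) (coeff-neg p i)) (ℚ.+-inverseʳ (coeff p i)))

  +ₚ-inverseˡ : ∀ p → -ₚ p +ₚ p ≈ₚ 0ₚ
  +ₚ-inverseˡ p i = trans (+ₚ-comm (-ₚ p) p i) (+ₚ-inverseʳ p i)

  -ₚ-cong : ∀ p q → p ≈ₚ q → -ₚ p ≈ₚ -ₚ q
  -ₚ-cong p q p≈q i = trans (coeff-neg p i) (trans (cong (λ a → ℚ.- a) (p≈q i)) (sym (coeff-neg q i)))

  *ₚ-congˡ : ∀ p q q′ → q ≈ₚ q′ → p *ₚ q ≈ₚ p *ₚ q′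
  *ₚ-congˡ []      q q′ q≈ i = refl
  *ₚ-congˡ (a ∷ p) q q′ q≈ i = begin
    coeff ((a ∷ p) *ₚ q) i                           ≡⟨ coeff-* a p q i ⟩
    a ℚ.* coeff q i ℚ.+ coeff (0ℚ ∷ (p *ₚ q)) i      ≡⟨ cong₂ ℚ._+_ (cong (a ℚ.*_) (q≈ i)) (∷-cong 0ℚ (*ₚ-congˡ p q q′ q≈) i) ⟩
    a ℚ.* coeff q′ i ℚ.+ coeff (0ℚ ∷ (p *ₚ q′)) i    ≡⟨ coeff-* a p q′ i ⟨
    coeff ((a ∷ p) *ₚ q′) i                          ∎

  *ₚ-distribˡ : ∀ p q r → p *ₚ (q +ₚ r) ≈ₚ p *ₚ q +ₚ p *ₚ r
  *ₚ-distribˡ []      q r i = refl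
  *ₚ-distribˡ (a ∷ p) q r i = begin
    coeff ((a ∷ p) *ₚ (q +ₚ r)) i
      ≡⟨ coeff-* a p (q +ₚ r) i ⟩
    a ℚ.* coeff (q +ₚ r) i ℚ.+ coeff (0ℚ ∷ (p *ₚ (q +ₚ r))) i
      ≡⟨ cong₂ ℚ._+_ (trans (cong (a ℚ.*_) (coeff-+ q r i)) (ℚ.*-distribˡ-+ a _ _))
                     (trans (∷-cong 0ℚ (*ₚ-distribˡ p q r) i) (coeff-shift-+ (p *ₚ q) (p *ₚ r) i)) ⟩
    (a ℚ.* coeff q i ℚ.+ a ℚ.* coeff r i) ℚ.+ (coeff (0ℚ ∷ (p *ₚ q)) i ℚ.+ coeff (0ℚ ∷ (p *ₚ r)) i)
      ≡⟨ interchange (a ℚ.* coeff q i) (a ℚ.* coeff r i) _ _ ⟩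
    (a ℚ.* coeff q i ℚ.+ coeff (0ℚ ∷ (p *ₚ q)) i) ℚ.+ (a ℚ.* coeff r i ℚ.+ coeff (0ℚ ∷ (p *ₚ r)) i)
      ≡⟨ cong₂ ℚ._+_ (coeff-* a p q i) (coeff-* a p r i) ⟨
    coeff ((a ∷ p) *ₚ q) i ℚ.+ coeff ((a ∷ p) *ₚ r) i
      ≡⟨ coeff-+ ((a ∷ p) *ₚ q) ((a ∷ p) *ₚ r) i ⟨
    coeff ((a ∷ p) *ₚ q +ₚ (a ∷ p) *ₚ r) i ∎

  *ₚ-zeroʳ : ∀ p → p *ₚ 0ₚ ≈ₚ 0ₚ
  *ₚ-zeroʳ []      i       = refl
  *ₚ-zeroʳ (a ∷ p) zero    = refl
  *ₚ-zeroʳ (a ∷ p) (suc i) = *ₚ-zeroʳ p i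

  -- The mirror image of `coeff-*`: multiplication recurses on its left argument, and this expansion
  -- on the right is what gives commutativity.
  coeff-*-∷ : ∀ p b q i → coeff (p *ₚ (b ∷ q)) i ≡ b ℚ.* coeff p i ℚ.+ coeff (0ℚ ∷ (p *ₚ q)) i
  coeff-*-∷ []      b q zero    = sym (trans (ℚ.+-identityʳ _) (ℚ.*-zeroʳ b))
  coeff-*-∷ []      b q (suc i) = sym (trans (ℚ.+-identityʳ _) (ℚ.*-zeroʳ b))
  coeff-*-∷ (a ∷ p) b q zero    = trans (coeff-* a p (b ∷ q) 0) (cong (ℚ._+ 0ℚ) (ℚ.*-comm a b))
  coeff-*-∷ (a ∷ p) b q (suc i) = begin
    coeff ((a ∷ p) *ₚ (b ∷ q)) (suc i)
      ≡⟨ coeff-* a p (b ∷ q) (suc i) ⟩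
    a ℚ.* coeff q i ℚ.+ coeff (p *ₚ (b ∷ q)) i
      ≡⟨ cong (a ℚ.* coeff q i ℚ.+_) (coeff-*-∷ p b q i) ⟩
    a ℚ.* coeff q i ℚ.+ (b ℚ.* coeff p i ℚ.+ coeff (0ℚ ∷ (p *ₚ q)) i)
      ≡⟨ x∙yz≈y∙xz (a ℚ.* coeff q i) (b ℚ.* coeff p i) _ ⟩
    b ℚ.* coeff p i ℚ.+ (a ℚ.* coeff q i ℚ.+ coeff (0ℚ ∷ (p *ₚ q)) i)
      ≡⟨ cong (b ℚ.* coeff p i ℚ.+_) (coeff-* a p q i) ⟨
    b ℚ.* coeff p i ℚ.+ coeff ((a ∷ p) *ₚ q) i ∎

  *ₚ-comm : ∀ p q → p *ₚ q ≈ₚ q *ₚ p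
  *ₚ-comm []      q i = sym (*ₚ-zeroʳ q i)
  *ₚ-comm (a ∷ p) q i = begin
    coeff ((a ∷ p) *ₚ q) i                         ≡⟨ coeff-* a p q i ⟩
    a ℚ.* coeff q i ℚ.+ coeff (0ℚ ∷ (p *ₚ q)) i    ≡⟨ cong (a ℚ.* coeff q i ℚ.+_) (∷-cong 0ℚ (*ₚ-comm p q) i) ⟩
    a ℚ.* coeff q i ℚ.+ coeff (0ℚ ∷ (q *ₚ p)) i    ≡⟨ coeff-*-∷ q a p i ⟨
    coeff (q *ₚ (a ∷ p)) i                         ∎

  *ₚ-congʳ : ∀ p p′ q → p ≈ₚ p′ → p *ₚ q ≈ₚ p′ *ₚ q
  *ₚ-congʳ p p′ q p≈ i = trans (*ₚ-comm p q i) (trans (*ₚ-congˡ q p p′ p≈ i) (*ₚ-comm q p′ i))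

  *ₚ-distribʳ : ∀ p q r → (q +ₚ r) *ₚ p ≈ₚ q *ₚ p +ₚ r *ₚ p
  *ₚ-distribʳ p q r i = begin
    coeff ((q +ₚ r) *ₚ p) i         ≡⟨ *ₚ-comm (q +ₚ r) p i ⟩
    coeff (p *ₚ (q +ₚ r)) i         ≡⟨ *ₚ-distribˡ p q r i ⟩
    coeff (p *ₚ q +ₚ p *ₚ r) i      ≡⟨ +ₚ-cong (p *ₚ q) (q *ₚ p) (p *ₚ r) (r *ₚ p) (*ₚ-comm p q) (*ₚ-comm p r) i ⟩
    coeff (q *ₚ p +ₚ r *ₚ p) i      ∎

  *ₚ-identityˡ : ∀ p → 1ₚ *ₚ p ≈ₚ p
  *ₚ-identityˡ p i = trans (coeff-* 1ℚ [] p i)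
    (trans (cong₂ ℚ._+_ (ℚ.*-identityˡ (coeff p i)) (0≈ i)) (ℚ.+-identityʳ _))
    where
    0≈ : ∀ i → coeff (0ℚ ∷ []) i ≡ 0ℚ
    0≈ zero    = refl
    0≈ (suc i) = refl

  *ₚ-identityʳ : ∀ p → p *ₚ 1ₚ ≈ₚ p
  *ₚ-identityʳ p i = trans (*ₚ-comm p 1ₚ i) (*ₚ-identityˡ p i)

  map-*-assoc : ∀ a p q → map (a ℚ.*_) p *ₚ q ≈ₚ map (a ℚ.*_) (p *ₚ q)
  map-*-assoc a []      q i = refl
  map-*-assoc a (b ∷ p) q i = begin
    coeff (map (a ℚ.*_) (b ∷ p) *ₚ q) i
      ≡⟨ coeff-* (a ℚ.* b) (map (a ℚ.*_) p) q i ⟩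
    a ℚ.* b ℚ.* coeff q i ℚ.+ coeff (0ℚ ∷ (map (a ℚ.*_) p *ₚ q)) i
      ≡⟨ cong₂ ℚ._+_ (ℚ.*-assoc a b (coeff q i))
                     (trans (∷-cong 0ℚ (map-*-assoc a p q) i) (coeff-shift-map a (p *ₚ q) i)) ⟩
    a ℚ.* (b ℚ.* coeff q i) ℚ.+ a ℚ.* coeff (0ℚ ∷ (p *ₚ q)) i
      ≡⟨ ℚ.*-distribˡ-+ a _ _ ⟨
    a ℚ.* (b ℚ.* coeff q i ℚ.+ coeff (0ℚ ∷ (p *ₚ q)) i)
      ≡⟨ cong (a ℚ.*_) (coeff-* b p q i) ⟨
    a ℚ.* coeff ((b ∷ p) *ₚ q) i
      ≡⟨ coeff-map-* a ((b ∷ p) *ₚ q) i ⟨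
    coeff (map (a ℚ.*_) ((b ∷ p) *ₚ q)) i ∎

  shift-*-assoc : ∀ p q → (0ℚ ∷ p) *ₚ q ≈ₚ 0ℚ ∷ (p *ₚ q)
  shift-*-assoc p q i = trans (coeff-* 0ℚ p q i)
    (trans (cong (ℚ._+ coeff (0ℚ ∷ (p *ₚ q)) i) (ℚ.*-zeroˡ (coeff q i))) (ℚ.+-identityˡ _))

  *ₚ-assoc : ∀ p q r → (p *ₚ q) *ₚ r ≈ₚ p *ₚ (q *ₚ r)
  *ₚ-assoc []      q r i = refl
  *ₚ-assoc (a ∷ p) q r i = begin
    coeff ((map (a ℚ.*_) q +ₚ (0ℚ ∷ (p *ₚ q))) *ₚ r) i
      ≡⟨ *ₚ-distribʳ r (map (a ℚ.*_) q) (0ℚ ∷ (p *ₚ q)) i ⟩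
    coeff (map (a ℚ.*_) q *ₚ r +ₚ (0ℚ ∷ (p *ₚ q)) *ₚ r) i
      ≡⟨ +ₚ-cong (map (a ℚ.*_) q *ₚ r) (map (a ℚ.*_) (q *ₚ r)) ((0ℚ ∷ (p *ₚ q)) *ₚ r) (0ℚ ∷ (p *ₚ (q *ₚ r)))
           (map-*-assoc a q r)
           (λ j → trans (shift-*-assoc (p *ₚ q) r j) (∷-cong 0ℚ (*ₚ-assoc p q r) j)) i ⟩
    coeff ((a ∷ p) *ₚ (q *ₚ r)) i ∎

ℚ[x]-commutativeRing : CommutativeRing 0ℓ 0ℓ
ℚ[x]-commutativeRing = record
  { Carrier = ℚ[x] ; _≈_ = _≈ₚ_
  ; _+_ = _+ₚ_ ; _*_ = _*ₚ_ ; -_ = -ₚ_ ; 0# = 0ₚ ; 1# = 1ₚ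
  ; isCommutativeRing = record
    { isRing = record
      { +-isAbelianGroup = record
        { isGroup = record
          { isMonoid = record
            { isSemigroup = record
              { isMagma = record
                { isEquivalence = record
                  { refl = λ _ → ≡.refl
                  ; sym = λ p≈q i → ≡.sym (p≈q i)
                  ; trans = λ p≈q q≈r i → ≡.trans (p≈q i) (q≈r i) }
                ; ∙-cong = λ {p} {p′} {q} {q′} → +ₚ-cong p p′ q q′ }
              ; assoc = +ₚ-assoc }
            ; identity = (λ p i → ≡.refl) , +ₚ-identityʳ }
          ; inverse = +ₚ-inverseˡ , +ₚ-inverseʳ
          ; ⁻¹-cong = λ {p} {q} → -ₚ-cong p q }
        ; comm = +ₚ-comm }
      ; *-cong = λ {p} {p′} {q} {q′} p≈ q≈ i →
          ≡.trans (*ₚ-congʳ p p′ q p≈ i) (*ₚ-congˡ p′ q q′ q≈ i)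
      ; *-assoc = *ₚ-assoc
      ; *-identity = *ₚ-identityˡ , *ₚ-identityʳ
      ; distrib = *ₚ-distribˡ , *ₚ-distribʳ }
    ; *-comm = *ₚ-comm } }
  where open PolynomialRing

const-*ₚ : ∀ a p i → coeff (const a *ₚ p) i ≡ a ℚ.* coeff p i
const-*ₚ a p zero    = ≡.trans (coeff-* a [] p 0) (ℚ.+-identityʳ _)
const-*ₚ a p (suc i) = ≡.trans (coeff-* a [] p (suc i)) (ℚ.+-identityʳ _)

const-isRingHomomorphism : RingMorphisms.IsRingHomomorphism
  (CommutativeRing.rawRing ℚ.+-*-commutativeRing) (CommutativeRing.rawRing ℚ[x]-commutativeRing) const
const-isRingHomomorphism = record
  { isSemiringHomomorphism = record
    { isNearSemiringHomomorphism = record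
      { +-isMonoidHomomorphism = record
        { isMagmaHomomorphism = record
          { isRelHomomorphism = record { cong = λ { ≡.refl _ → ≡.refl } }
          ; homo = λ a b i → ≡.refl }
        ; ε-homo = λ { zero → ≡.refl ; (suc i) → ≡.refl } }
      ; *-homo = λ { a b zero → ≡.sym (ℚ.+-identityʳ _) ; a b (suc i) → ≡.refl } }
    ; 1#-homo = λ _ → ≡.refl }
  ; -‿homo = λ a i → ≡.refl }

-- Degree bounds and exact degrees

module Degree where
  open PolynomialRing
  open ≡ using (refl; sym; trans; cong; cong₂)
  open ≡.≡-Reasoning

  -- The bound deg p < d, in a form that ignores trailing zeros and holds for the zero polynomial
  -- with d = 0, where `degree` would answer 0.
  record VanishesFrom (d : ℕ) (p : ℚ[x]) : Set where
    constructor vanishes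
    field coeff≡0 : ∀ i → d ℕ.≤ i → coeff p i ≡ 0ℚ
  open VanishesFrom public

  VanishesFrom-resp : ∀ {d p q} → p ≈ₚ q → VanishesFrom d p → VanishesFrom d q
  VanishesFrom-resp p≈q (vanishes p₀) = vanishes λ i d≤i → trans (sym (p≈q i)) (p₀ i d≤i)

  VanishesFrom-≤ : ∀ {d e p} → d ℕ.≤ e → VanishesFrom d p → VanishesFrom e p
  VanishesFrom-≤ d≤e (vanishes p₀) = vanishes λ i e≤i → p₀ i (ℕ.≤-trans d≤e e≤i)

  VanishesFrom-[] : ∀ {d} → VanishesFrom d []
  VanishesFrom-[] = vanishes λ i _ → refl

  VanishesFrom-∷ : ∀ {d a p} → VanishesFrom d p → VanishesFrom (suc d) (a ∷ p)
  VanishesFrom-∷ (vanishes p₀) = vanishes λ { (suc i) (s≤s d≤i) → p₀ i d≤i }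

  VanishesFrom-tail : ∀ {d a p} → VanishesFrom (suc d) (a ∷ p) → VanishesFrom d p
  VanishesFrom-tail (vanishes p₀) = vanishes λ i d≤i → p₀ (suc i) (s≤s d≤i)

  VanishesFrom-0⇒≈0 : ∀ {p} → VanishesFrom 0 p → p ≈ₚ 0ₚ
  VanishesFrom-0⇒≈0 (vanishes p₀) i = p₀ i z≤n

  VanishesFrom-+ : ∀ {d p q} → VanishesFrom d p → VanishesFrom d q → VanishesFrom d (p +ₚ q)
  VanishesFrom-+ {d} {p} {q} (vanishes p₀) (vanishes q₀) = vanishes λ i d≤i →
    trans (coeff-+ p q i) (cong₂ ℚ._+_ (p₀ i d≤i) (q₀ i d≤i))

  VanishesFrom-neg : ∀ {d p} → VanishesFrom d p → VanishesFrom d (-ₚ p)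
  VanishesFrom-neg {d} {p} (vanishes p₀) = vanishes λ i d≤i →
    trans (coeff-neg p i) (cong (λ a → ℚ.- a) (p₀ i d≤i))

  VanishesFrom-sum : ∀ {d k} (g : Vector ℚ[x] k) → (∀ l → VanishesFrom d (g l)) → VanishesFrom d (sumₚ g)
  VanishesFrom-sum {k = zero}  g g₀ = VanishesFrom-[]
  VanishesFrom-sum {k = suc k} g g₀ = VanishesFrom-+ (g₀ zero) (VanishesFrom-sum (g ∘ suc) (g₀ ∘ suc))

  shift-zero : ∀ {p} i → (∀ l → suc l ≡ i → coeff p l ≡ 0ℚ) → coeff (0ℚ ∷ p) i ≡ 0ℚ
  shift-zero zero    p₀ = refl
  shift-zero (suc i) p₀ = p₀ i refl

  VanishesFrom-0-* : ∀ {p} q → VanishesFrom 0 p → p *ₚ q ≈ₚ 0ₚ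
  VanishesFrom-0-* {p} q p₀ = *ₚ-congʳ p [] q (VanishesFrom-0⇒≈0 p₀)

  -- The bounds are deg p ≤ d and deg q < e; one weak and one strict bound add up without a
  -- predecessor.
  VanishesFrom-* : ∀ {d e} p q → VanishesFrom (suc d) p → VanishesFrom e q → VanishesFrom (d ℕ.+ e) (p *ₚ q)
  VanishesFrom-* []      q p₀ q₀ = VanishesFrom-[]
  VanishesFrom-* {d} {e} (a ∷ p) q p₀ q₀ = vanishes λ i d+e≤i → begin
    coeff ((a ∷ p) *ₚ q) i                         ≡⟨ coeff-* a p q i ⟩
    a ℚ.* coeff q i ℚ.+ coeff (0ℚ ∷ (p *ₚ q)) i    ≡⟨ cong₂ ℚ._+_ (cong (a ℚ.*_) (coeff≡0 q₀ i (ℕ.≤-trans (ℕ.m≤n+m e d) d+e≤i)))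
                                                                    (shift-zero i λ l l+1≡i → rest d p₀ l (ℕ.≤-trans d+e≤i (ℕ.≤-reflexive (sym l+1≡i)))) ⟩
    a ℚ.* 0ℚ ℚ.+ 0ℚ                                ≡⟨ ℚ.+-identityʳ _ ⟩
    a ℚ.* 0ℚ                                       ≡⟨ ℚ.*-zeroʳ a ⟩
    0ℚ                                             ∎
    where
    rest : ∀ d → VanishesFrom (suc d) (a ∷ p) → ∀ l → d ℕ.+ e ℕ.≤ suc l → coeff (p *ₚ q) l ≡ 0ℚ
    rest zero    p₀ l _           = VanishesFrom-0-* q (VanishesFrom-tail p₀) l
    rest (suc d) p₀ l (s≤s d+e≤l) = coeff≡0 (VanishesFrom-* p q (VanishesFrom-tail p₀) q₀) l d+e≤l

  -- Exact degree as a relation: it is built up along products and meets the computed `degree` only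
  -- in `HasDegree⇒degree`.
  record HasDegree (p : ℚ[x]) (d : ℕ) : Set where
    constructor hasDegree
    field
      vanishes-above : VanishesFrom (suc d) p
      leading-≢0     : coeff p d ≢ 0ℚ
  open HasDegree public

  HasDegree-resp : ∀ {d p q} → p ≈ₚ q → HasDegree p d → HasDegree q d
  HasDegree-resp p≈q (hasDegree p₀ pd≢0) =
    hasDegree (VanishesFrom-resp p≈q p₀) (pd≢0 ∘ trans (p≈q _))

  HasDegree-∷ : ∀ {d a p} → HasDegree p d → HasDegree (a ∷ p) (suc d)
  HasDegree-∷ (hasDegree p₀ pd≢0) = hasDegree (VanishesFrom-∷ p₀) pd≢0

  HasDegree⇒NonZero : ∀ {p d} → HasDegree p d → NonZeroₚ p
  HasDegree⇒NonZero {d = d} deg = nonZeroₚ λ p≈0 → leading-≢0 deg (p≈0 d)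

  HasDegree⇒degree : ∀ p {d} → HasDegree p d → degree p ≡ d
  HasDegree⇒degree [] deg = contradiction refl (leading-≢0 deg)
  HasDegree⇒degree (a ∷ p) {d} deg with ≈0? p
  HasDegree⇒degree (a ∷ p) {zero}  deg | yes p≈0 = refl
  HasDegree⇒degree (a ∷ p) {suc d} deg | yes p≈0 = contradiction (p≈0 d) (leading-≢0 deg)
  HasDegree⇒degree (a ∷ p) {zero}  deg | no p≉0 =
    contradiction (VanishesFrom-0⇒≈0 (VanishesFrom-tail (vanishes-above deg))) p≉0
  HasDegree⇒degree (a ∷ p) {suc d} deg | no p≉0 =
    cong suc (HasDegree⇒degree p (hasDegree (VanishesFrom-tail (vanishes-above deg)) (leading-≢0 deg)))

  HasDegree-unique : ∀ {p d e} → HasDegree p d → HasDegree p e → d ≡ e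
  HasDegree-unique {p} deg deg′ = trans (sym (HasDegree⇒degree p deg)) (HasDegree⇒degree p deg′)

  coeff-*-top : ∀ {d e} p q → VanishesFrom (suc d) p → VanishesFrom (suc e) q →
                coeff (p *ₚ q) (d ℕ.+ e) ≡ coeff p d ℚ.* coeff q e
  coeff-*-top {d} {e} [] q p₀ q₀ = sym (ℚ.*-zeroˡ (coeff q e))
  coeff-*-top {zero} {e} (a ∷ p) q p₀ q₀ = begin
    coeff ((a ∷ p) *ₚ q) e                         ≡⟨ coeff-* a p q e ⟩
    a ℚ.* coeff q e ℚ.+ coeff (0ℚ ∷ (p *ₚ q)) e    ≡⟨ cong (a ℚ.* coeff q e ℚ.+_) (shift-zero e λ l _ → VanishesFrom-0-* q (VanishesFrom-tail p₀) l) ⟩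
    a ℚ.* coeff q e ℚ.+ 0ℚ                         ≡⟨ ℚ.+-identityʳ _ ⟩
    a ℚ.* coeff q e                                ∎
  coeff-*-top {suc d} {e} (a ∷ p) q p₀ q₀ = begin
    coeff ((a ∷ p) *ₚ q) (suc d ℕ.+ e)                         ≡⟨ coeff-* a p q (suc d ℕ.+ e) ⟩
    a ℚ.* coeff q (suc d ℕ.+ e) ℚ.+ coeff (p *ₚ q) (d ℕ.+ e)   ≡⟨ cong₂ ℚ._+_ (trans (cong (a ℚ.*_) (coeff≡0 q₀ _ (s≤s (ℕ.m≤n+m e d)))) (ℚ.*-zeroʳ a))
                                                                              (coeff-*-top p q (VanishesFrom-tail p₀) q₀) ⟩
    0ℚ ℚ.+ coeff p d ℚ.* coeff q e                             ≡⟨ ℚ.+-identityˡ _ ⟩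
    coeff p d ℚ.* coeff q e                                    ∎

  a≢0∧ab≡0⇒b≡0 : ∀ {a b} → a ≢ 0ℚ → a ℚ.* b ≡ 0ℚ → b ≡ 0ℚ
  a≢0∧ab≡0⇒b≡0 {a} {b} a≢0 ab≡0 = begin
    b                       ≡⟨ ℚ.*-identityˡ b ⟨
    1ℚ ℚ.* b                ≡⟨ cong (ℚ._* b) (ℚ.*-inverseˡ a) ⟨
    ℚ.1/ a ℚ.* a ℚ.* b      ≡⟨ ℚ.*-assoc (ℚ.1/ a) a b ⟩
    ℚ.1/ a ℚ.* (a ℚ.* b)    ≡⟨ cong (ℚ.1/ a ℚ.*_) ab≡0 ⟩
    ℚ.1/ a ℚ.* 0ℚ           ≡⟨ ℚ.*-zeroʳ (ℚ.1/ a) ⟩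
    0ℚ                      ∎
    where
    instance
      a-nonZero : ℚ.NonZero a
      a-nonZero = ℚ.≢-nonZero a≢0

  HasDegree-* : ∀ {p q d e} → HasDegree p d → HasDegree q e → HasDegree (p *ₚ q) (d ℕ.+ e)
  HasDegree-* {p} {q} {d} {e} (hasDegree p₀ pd≢0) (hasDegree q₀ qe≢0) = hasDegree
    (VanishesFrom-≤ (ℕ.≤-reflexive (ℕ.+-suc d e)) (VanishesFrom-* p q p₀ q₀))
    (λ pq≡0 → qe≢0 (a≢0∧ab≡0⇒b≡0 pd≢0 (trans (sym (coeff-*-top p q p₀ q₀)) pq≡0)))

  HasDegree-1 : HasDegree 1ₚ 0
  HasDegree-1 = hasDegree (VanishesFrom-∷ VanishesFrom-[]) λ ()

  HasDegree-^ : ∀ {p} → HasDegree p 1 → ∀ e → HasDegree (p ^ₚ e) e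
  HasDegree-^ deg zero    = HasDegree-1
  HasDegree-^ deg (suc e) = HasDegree-* deg (HasDegree-^ deg e)

  HasDegree-product : ∀ {k} (g : Vector ℚ[x] k) (d : Vector ℕ k) →
                      (∀ l → HasDegree (g l) (d l)) → HasDegree (Sumsₚ.product g) (Sumsℕ.sum d)
  HasDegree-product {zero}  g d deg = HasDegree-1
  HasDegree-product {suc k} g d deg = HasDegree-* (deg zero) (HasDegree-product (g ∘ suc) (d ∘ suc) (deg ∘ suc))

  -- For a quotient b + x q, the part b p reaches no coefficient above d, so p q inherits the bound
  -- and the induction applies to q. When e = 0 this gives q = 0 first; the coefficient at d is then
  -- b times the leading coefficient of p, so b = 0.
  quotient-vanishes : ∀ {p d e} → HasDegree p d → ∀ q → VanishesFrom (d ℕ.+ e) (p *ₚ q) → VanishesFrom e q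
  quotient-vanishes deg [] pq₀ = VanishesFrom-[]
  quotient-vanishes {p} {d} {suc e} deg (b ∷ q) pq₀ =
    VanishesFrom-∷ (quotient-vanishes {e = e} deg q (vanishes λ i d+e≤i → begin
      coeff (p *ₚ q) i                                 ≡⟨ ℚ.+-identityˡ _ ⟨
      0ℚ ℚ.+ coeff (p *ₚ q) i                          ≡⟨ cong (ℚ._+ _) (trans (cong (b ℚ.*_) (coeff≡0 (vanishes-above deg) (suc i) (s≤s (ℕ.≤-trans (ℕ.m≤m+n d e) d+e≤i)))) (ℚ.*-zeroʳ b)) ⟨
      b ℚ.* coeff p (suc i) ℚ.+ coeff (p *ₚ q) i       ≡⟨ coeff-*-∷ p b q (suc i) ⟨
      coeff (p *ₚ (b ∷ q)) (suc i)                     ≡⟨ coeff≡0 pq₀ (suc i) (ℕ.≤-trans (ℕ.≤-reflexive (ℕ.+-suc d e)) (s≤s d+e≤i)) ⟩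
      0ℚ                                               ∎))
  quotient-vanishes {p} {d} {zero} deg (b ∷ q) pq₀ = vanishes λ
    { zero _ → b≡0 ; (suc i) _ → coeff≡0 q₀ i z≤n }
    where
    q₀ : VanishesFrom 0 q
    q₀ = quotient-vanishes {e = 0} deg q (VanishesFrom-tail {a = 0ℚ} (vanishes λ
      { (suc i) (s≤s d+0≤i) → begin
        coeff (p *ₚ q) i                                 ≡⟨ ℚ.+-identityˡ _ ⟨
        0ℚ ℚ.+ coeff (p *ₚ q) i                          ≡⟨ cong (ℚ._+ _) (trans (cong (b ℚ.*_) (coeff≡0 (vanishes-above deg) (suc i) (s≤s (ℕ.≤-trans (ℕ.m≤m+n d 0) d+0≤i)))) (ℚ.*-zeroʳ b)) ⟨
        b ℚ.* coeff p (suc i) ℚ.+ coeff (p *ₚ q) i       ≡⟨ coeff-*-∷ p b q (suc i) ⟨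
        coeff (p *ₚ (b ∷ q)) (suc i)                     ≡⟨ coeff≡0 pq₀ (suc i) (ℕ.m≤n⇒m≤1+n d+0≤i) ⟩
        0ℚ                                               ∎ }))
    b≡0 : b ≡ 0ℚ
    b≡0 = a≢0∧ab≡0⇒b≡0 (leading-≢0 deg) (begin
      coeff p d ℚ.* b                                ≡⟨ ℚ.*-comm (coeff p d) b ⟩
      b ℚ.* coeff p d                                ≡⟨ ℚ.+-identityʳ _ ⟨
      b ℚ.* coeff p d ℚ.+ 0ℚ                         ≡⟨ cong (b ℚ.* coeff p d ℚ.+_) (shift-zero d λ l _ → trans (*ₚ-congˡ p q [] (VanishesFrom-0⇒≈0 q₀) l) (*ₚ-zeroʳ p l)) ⟨
      b ℚ.* coeff p d ℚ.+ coeff (0ℚ ∷ (p *ₚ q)) d    ≡⟨ coeff-*-∷ p b q d ⟨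
      coeff (p *ₚ (b ∷ q)) d                         ≡⟨ coeff≡0 pq₀ d (ℕ.≤-reflexive (ℕ.+-identityʳ d)) ⟩
      0ℚ                                             ∎)

-- Euclidean remainders as canonical representatives

module Remainder where
  open PolynomialRing
  open Degree
  open ≡ using (refl; sym; trans; cong; cong₂; subst)
  private module P = CommutativeRing ℚ[x]-commutativeRing
  open Ring ℚ[x]-commutativeRing

  rem-≋ : ∀ f p p≉0 → f rem p ∵ p≉0 ≋ f [mod p ]
  rem-≋ []      p p≉0 = ≈⇒≋ λ _ → refl
  rem-≋ (a ∷ f) p p≉0 = reduce (rem-≋ f p p≉0) (coeff (a ∷ (f rem p ∵ p≉0)) (degree p) ℚ.÷ leading p)
    where
    instance
      leading-nonZero : ℚ.NonZero (leading p)
      leading-nonZero = ℚ.≢-nonZero (leading≢0 p p≉0)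
    -- Any multiple of p may be subtracted, so b is arbitrary; its particular value matters only for
    -- the degree.
    reduce : ∀ {r} → r ≋ f [mod p ] → ∀ b → (a ∷ r) -ₚ const b *ₚ p ≋ a ∷ f [mod p ]
    reduce {r} (modulo q r≈) b = ≋-trans
      (≋-+-cong a∷r≋a∷f (≋-‿cong (q*p≋0 (const b) p)))
      (≈⇒≋ (+ₚ-identityʳ (a ∷ f)))
      where
      a∷r≋a∷f : a ∷ r ≋ a ∷ f [mod p ]
      -- From r = f + q p follows a + x r = (a + x f) + (x q) p.
      a∷r≋a∷f = modulo (0ℚ ∷ q) λ
        { zero    → sym (trans (coeff-+ (a ∷ f) ((0ℚ ∷ q) *ₚ p) 0)
                    (trans (cong (a ℚ.+_) (shift-*-assoc q p 0)) (ℚ.+-identityʳ a)))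
        ; (suc i) → trans (r≈ i) (trans (coeff-+ f (q *ₚ p) i)
                    (sym (trans (coeff-+ (a ∷ f) ((0ℚ ∷ q) *ₚ p) (suc i))
                                (cong (coeff f i ℚ.+_) (shift-*-assoc q p (suc i)))))) }

  rem-vanishes : ∀ f p p≉0 {d} → HasDegree p d → VanishesFrom d (f rem p ∵ p≉0)
  rem-vanishes []      p p≉0 deg = VanishesFrom-[]
  rem-vanishes (a ∷ f) p p≉0 {d} deg = vanishes λ i d≤i → begin
    coeff (s -ₚ const b *ₚ p) i                  ≡⟨ coeff-+ s (-ₚ (const b *ₚ p)) i ⟩
    coeff s i ℚ.+ coeff (-ₚ (const b *ₚ p)) i    ≡⟨ cong (coeff s i ℚ.+_) (trans (coeff-neg (const b *ₚ p) i) (cong (λ c → ℚ.- c) (const-*ₚ b p i))) ⟩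
    coeff s i ℚ.+ ℚ.- (b ℚ.* coeff p i)          ≡⟨ cong (λ c → coeff s i ℚ.+ ℚ.- c) (bp≡s i d≤i) ⟩
    coeff s i ℚ.+ ℚ.- coeff s i                  ≡⟨ ℚ.+-inverseʳ (coeff s i) ⟩
    0ℚ                                           ∎
    where
    open ≡.≡-Reasoning
    s : ℚ[x]
    s = a ∷ (f rem p ∵ p≉0)
    instance
      leading-nonZero : ℚ.NonZero (leading p)
      leading-nonZero = ℚ.≢-nonZero (leading≢0 p p≉0)
    b : ℚ
    b = coeff s (degree p) ℚ.÷ leading p
    bp≡s : ∀ i → d ℕ.≤ i → b ℚ.* coeff p i ≡ coeff s i
    bp≡s i d≤i with ℕ.m≤n⇒m<n∨m≡n d≤i
    ... | inj₁ d<i = begin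
      b ℚ.* coeff p i    ≡⟨ cong (λ c → b ℚ.* c) (coeff≡0 (vanishes-above deg) i d<i) ⟩
      b ℚ.* 0ℚ           ≡⟨ ℚ.*-zeroʳ b ⟩
      0ℚ                 ≡⟨ coeff≡0 (VanishesFrom-∷ {a = a} (rem-vanishes f p p≉0 deg)) i d<i ⟨
      coeff s i          ∎
    -- The factor b is defined through `degree p`, so the cancellation is proved at that index and
    -- carried to i along degree p = d = i.
    ... | inj₂ d≡i = subst (λ i → b ℚ.* coeff p i ≡ coeff s i) (trans (HasDegree⇒degree p deg) d≡i) (begin
      coeff s (degree p) ℚ.* ℚ.1/ leading p ℚ.* leading p      ≡⟨ ℚ.*-assoc (coeff s (degree p)) _ _ ⟩
      coeff s (degree p) ℚ.* (ℚ.1/ leading p ℚ.* leading p)    ≡⟨ cong (coeff s (degree p) ℚ.*_) (ℚ.*-inverseˡ (leading p)) ⟩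
      coeff s (degree p) ℚ.* 1ℚ                                ≡⟨ ℚ.*-identityʳ _ ⟩
      coeff s (degree p)                                       ∎)

  -- Since f - g = q p and deg p = d, a bound d + e on f and g leaves e for q. With e = 0 the two
  -- sides are equal; with e = 1 the quotient is constant.
  ≋⇒quotient-vanishes : ∀ {f g p d e} → HasDegree p d → VanishesFrom (d ℕ.+ e) f → VanishesFrom (d ℕ.+ e) g →
    (f≋g : f ≋ g [mod p ]) → VanishesFrom e (_≋_[mod_].quotient f≋g)
  ≋⇒quotient-vanishes {f} {g} {p} deg f₀ g₀ (modulo q f≈) = quotient-vanishes deg q
    (VanishesFrom-resp f-g≈pq (VanishesFrom-+ f₀ (VanishesFrom-neg g₀)))
    where
    open import Relation.Binary.Reasoning.Setoid P.setoid
    f-g≈pq : f -ₚ g ≈ₚ p *ₚ q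
    f-g≈pq = begin
      f -ₚ g                   ≈⟨ +ₚ-cong f (g +ₚ q *ₚ p) (-ₚ g) (-ₚ g) f≈ (λ _ → refl) ⟩
      (g +ₚ q *ₚ p) -ₚ g       ≈⟨ +ₚ-cong (g +ₚ q *ₚ p) (q *ₚ p +ₚ g) (-ₚ g) (-ₚ g) (+ₚ-comm g (q *ₚ p)) (λ _ → refl) ⟩
      (q *ₚ p +ₚ g) -ₚ g       ≈⟨ +ₚ-assoc (q *ₚ p) g (-ₚ g) ⟩
      q *ₚ p +ₚ (g -ₚ g)       ≈⟨ +ₚ-cong (q *ₚ p) (q *ₚ p) (g -ₚ g) [] (λ _ → refl) (+ₚ-inverseʳ g) ⟩
      q *ₚ p +ₚ []             ≈⟨ +ₚ-identityʳ (q *ₚ p) ⟩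
      q *ₚ p                   ≈⟨ *ₚ-comm q p ⟩
      p *ₚ q                   ∎

  ≋⇒≈ : ∀ {f g p d} → HasDegree p d → VanishesFrom d f → VanishesFrom d g → f ≋ g [mod p ] → f ≈ₚ g
  ≋⇒≈ {f} {g} {p} {d} deg f₀ g₀ f≋g@(modulo q f≈) i = begin
    coeff f i                           ≡⟨ f≈ i ⟩
    coeff (g +ₚ q *ₚ p) i               ≡⟨ coeff-+ g (q *ₚ p) i ⟩
    coeff g i ℚ.+ coeff (q *ₚ p) i      ≡⟨ cong (coeff g i ℚ.+_) (VanishesFrom-0-* p q₀ i) ⟩
    coeff g i ℚ.+ 0ℚ                    ≡⟨ ℚ.+-identityʳ _ ⟩
    coeff g i                           ∎
    where
    open ≡.≡-Reasoning
    d≤d+0 : d ℕ.≤ d ℕ.+ 0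
    d≤d+0 = ℕ.m≤m+n d 0
    q₀ : VanishesFrom 0 q
    q₀ = ≋⇒quotient-vanishes deg (VanishesFrom-≤ d≤d+0 f₀) (VanishesFrom-≤ d≤d+0 g₀) f≋g

-- Natural numbers in ℚ

module ℕ/1 where
  open ≡ using (refl; sym; trans; cong; cong₂)

  fromℕ : ℕ → ℚ
  fromℕ n = + n ℚ./ 1

  -- Division in ℚ normalises by a gcd and is stuck on variables; passing to unnormalised fractions
  -- leaves integer identities for the solver.
  toℚᵘ-/ : ∀ i d .⦃ _ : ℕ.NonZero d ⦄ → ℚ.toℚᵘ (i ℚ./ d) ℚᵘ.≃ i ℚᵘ./ d
  toℚᵘ-/ i (suc d) = ℚ.toℚᵘ-fromℚᵘ (ℚᵘ.mkℚᵘ i d)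

  fromℕ-suc : ∀ n → fromℕ (suc n) ≡ 1ℚ ℚ.+ fromℕ n
  fromℕ-suc n = ℚ.toℚᵘ-injective (begin
    ℚ.toℚᵘ (fromℕ (suc n))              ≈⟨ toℚᵘ-/ (+ suc n) 1 ⟩
    + suc n ℚᵘ./ 1                      ≈⟨ ℚᵘ.*≡* (identity (+ n)) ⟩
    ℚᵘ.1ℚᵘ ℚᵘ.+ (+ n ℚᵘ./ 1)            ≈⟨ ℚᵘ.+-cong ℚᵘ.≃-refl (toℚᵘ-/ (+ n) 1) ⟨
    ℚᵘ.1ℚᵘ ℚᵘ.+ ℚ.toℚᵘ (fromℕ n)        ≈⟨ ℚ.toℚᵘ-homo-+ 1ℚ (fromℕ n) ⟨
    ℚ.toℚᵘ (1ℚ ℚ.+ fromℕ n)             ∎)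
    where
    open ℚᵘ.≃-Reasoning
    identity : ∀ i → (1ℤ ℤ.+ i) ℤ.* (1ℤ ℤ.* 1ℤ) ≡ (1ℤ ℤ.* 1ℤ ℤ.+ i ℤ.* 1ℤ) ℤ.* 1ℤ
    identity = solve-∀

  fromℕ-* : ∀ m n → fromℕ (m ℕ.* n) ≡ fromℕ m ℚ.* fromℕ n
  fromℕ-* zero    n = sym (ℚ.*-zeroˡ (fromℕ n))
  fromℕ-* (suc m) n = begin
    fromℕ (n ℕ.+ m ℕ.* n)               ≡⟨ fromℕ-+ n (m ℕ.* n) ⟩
    fromℕ n ℚ.+ fromℕ (m ℕ.* n)         ≡⟨ cong₂ ℚ._+_ (sym (ℚ.*-identityˡ (fromℕ n))) (fromℕ-* m n) ⟩
    1ℚ ℚ.* fromℕ n ℚ.+ fromℕ m ℚ.* fromℕ n ≡⟨ ℚ.*-distribʳ-+ (fromℕ n) 1ℚ (fromℕ m) ⟨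
    (1ℚ ℚ.+ fromℕ m) ℚ.* fromℕ n        ≡⟨ cong (ℚ._* fromℕ n) (fromℕ-suc m) ⟨
    fromℕ (suc m) ℚ.* fromℕ n           ∎
    where
    open ≡.≡-Reasoning
    fromℕ-+ : ∀ m n → fromℕ (m ℕ.+ n) ≡ fromℕ m ℚ.+ fromℕ n
    fromℕ-+ zero    n = sym (ℚ.+-identityˡ (fromℕ n))
    fromℕ-+ (suc m) n = trans (fromℕ-suc (m ℕ.+ n)) (trans (cong (1ℚ ℚ.+_) (fromℕ-+ m n))
      (trans (sym (ℚ.+-assoc 1ℚ (fromℕ m) (fromℕ n))) (cong (ℚ._+ fromℕ n) (sym (fromℕ-suc m)))))

  1/n*n≡1 : ∀ n .⦃ _ : ℕ.NonZero n ⦄ → (+ 1 ℚ./ n) ℚ.* fromℕ n ≡ 1ℚ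
  1/n*n≡1 n@(suc _) = ℚ.toℚᵘ-injective (begin
    ℚ.toℚᵘ ((+ 1 ℚ./ n) ℚ.* fromℕ n)             ≈⟨ ℚ.toℚᵘ-homo-* (+ 1 ℚ./ n) (fromℕ n) ⟩
    ℚ.toℚᵘ (+ 1 ℚ./ n) ℚᵘ.* ℚ.toℚᵘ (fromℕ n)     ≈⟨ ℚᵘ.*-cong (toℚᵘ-/ (+ 1) n) (toℚᵘ-/ (+ n) 1) ⟩
    (+ 1 ℚᵘ./ n) ℚᵘ.* (+ n ℚᵘ./ 1)               ≈⟨ ℚᵘ.*≡* (identity (+ n)) ⟩
    ℚᵘ.1ℚᵘ                                       ∎)
    where
    open ℚᵘ.≃-Reasoning
    identity : ∀ i → 1ℤ ℤ.* i ℤ.* 1ℤ ≡ 1ℤ ℤ.* (i ℤ.* 1ℤ)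
    identity = solve-∀

  fromℕ-product : ∀ {k} (n : Vector ℕ k) → fromℕ (Sumsℕ.product n) ≡ Sumsℚ.product (fromℕ ∘ n)
  fromℕ-product {zero}  n = refl
  fromℕ-product {suc k} n = trans (fromℕ-* (n zero) _) (cong (fromℕ (n zero) ℚ.*_) (fromℕ-product (n ∘ suc)))

-- Evaluation at 1 as a ring homomorphism

module ValueAt1 where
  open PolynomialRing
  open ≡ using (refl; sym; trans; cong; cong₂)
  open ≡.≡-Reasoning
  open Algebra.Properties.CommutativeSemigroup (CommutativeRing.+-commutativeSemigroup ℚ.+-*-commutativeRing) using (interchange)

  value : ℚ[x] → ℚ
  value p = eval p 1ℚ

  value-∷ : ∀ a p → value (a ∷ p) ≡ a ℚ.+ value p
  value-∷ a p = cong (a ℚ.+_) (ℚ.*-identityˡ (value p))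

  value-≈0 : ∀ p → p ≈ₚ 0ₚ → value p ≡ 0ℚ
  value-≈0 []      p≈0 = refl
  value-≈0 (a ∷ p) p≈0 = trans (value-∷ a p) (cong₂ ℚ._+_ (p≈0 0) (value-≈0 p (p≈0 ∘ suc)))

  value-cong : ∀ p q → p ≈ₚ q → value p ≡ value q
  value-cong []      q       p≈q = sym (value-≈0 q (sym ∘ p≈q))
  value-cong (a ∷ p) []      p≈q = value-≈0 (a ∷ p) p≈q
  value-cong (a ∷ p) (b ∷ q) p≈q = cong₂ (λ a v → a ℚ.+ 1ℚ ℚ.* v) (p≈q 0) (value-cong p q (p≈q ∘ suc))

  value-+ : ∀ p q → value (p +ₚ q) ≡ value p ℚ.+ value q
  value-+ []      q       = sym (ℚ.+-identityˡ (value q))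
  value-+ (a ∷ p) []      = sym (ℚ.+-identityʳ (value (a ∷ p)))
  value-+ (a ∷ p) (b ∷ q) = begin
    value (a ℚ.+ b ∷ p +ₚ q)                       ≡⟨ value-∷ (a ℚ.+ b) (p +ₚ q) ⟩
    a ℚ.+ b ℚ.+ value (p +ₚ q)                     ≡⟨ cong (a ℚ.+ b ℚ.+_) (value-+ p q) ⟩
    a ℚ.+ b ℚ.+ (value p ℚ.+ value q)              ≡⟨ interchange a b (value p) (value q) ⟩
    (a ℚ.+ value p) ℚ.+ (b ℚ.+ value q)            ≡⟨ cong₂ ℚ._+_ (value-∷ a p) (value-∷ b q) ⟨
    value (a ∷ p) ℚ.+ value (b ∷ q)                ∎

  value-map : ∀ a p → value (map (a ℚ.*_) p) ≡ a ℚ.* value p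
  value-map a []      = sym (ℚ.*-zeroʳ a)
  value-map a (b ∷ p) = begin
    value (a ℚ.* b ∷ map (a ℚ.*_) p)        ≡⟨ value-∷ (a ℚ.* b) (map (a ℚ.*_) p) ⟩
    a ℚ.* b ℚ.+ value (map (a ℚ.*_) p)      ≡⟨ cong (a ℚ.* b ℚ.+_) (value-map a p) ⟩
    a ℚ.* b ℚ.+ a ℚ.* value p               ≡⟨ ℚ.*-distribˡ-+ a b (value p) ⟨
    a ℚ.* (b ℚ.+ value p)                   ≡⟨ cong (a ℚ.*_) (value-∷ b p) ⟨
    a ℚ.* value (b ∷ p)                     ∎

  value-* : ∀ p q → value (p *ₚ q) ≡ value p ℚ.* value q
  value-* []      q = sym (ℚ.*-zeroˡ (value q))
  value-* (a ∷ p) q = begin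
    value (map (a ℚ.*_) q +ₚ (0ℚ ∷ (p *ₚ q)))            ≡⟨ value-+ (map (a ℚ.*_) q) (0ℚ ∷ (p *ₚ q)) ⟩
    value (map (a ℚ.*_) q) ℚ.+ value (0ℚ ∷ (p *ₚ q))     ≡⟨ cong₂ ℚ._+_ (value-map a q) (trans (value-∷ 0ℚ (p *ₚ q)) (trans (ℚ.+-identityˡ _) (value-* p q))) ⟩
    a ℚ.* value q ℚ.+ value p ℚ.* value q                ≡⟨ ℚ.*-distribʳ-+ (value q) a (value p) ⟨
    (a ℚ.+ value p) ℚ.* value q                          ≡⟨ cong (ℚ._* value q) (value-∷ a p) ⟨
    value (a ∷ p) ℚ.* value q                            ∎

-- The derivative by coefficients

module Derivative where
  open ≡ using (refl; sym; trans; cong; cong₂)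
  open import Algebra.Properties.Semiring.Mult (CommutativeRing.semiring ℚ.+-*-commutativeRing) using (_×_)

  -- `deriv` recurses on the list, which does not show that it respects `_≈ₚ_`; a formula for each
  -- coefficient does.
  coeff-deriv : ∀ p i → coeff (deriv p) i ≡ suc i × coeff p (suc i)
  coeff-deriv []      i       = sym (0× (suc i))
    where
    0× : ∀ i → i × 0ℚ ≡ 0ℚ
    0× zero    = refl
    0× (suc i) = trans (ℚ.+-identityˡ _) (0× i)
  coeff-deriv (a ∷ p) zero    = coeff-+ p (0ℚ ∷ deriv p) 0
  coeff-deriv (a ∷ p) (suc i) = trans (coeff-+ p (0ℚ ∷ deriv p) (suc i))
    (cong (coeff p (suc i) ℚ.+_) (coeff-deriv p i))

  deriv-cong : ∀ p q → p ≈ₚ q → deriv p ≈ₚ deriv q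
  deriv-cong p q p≈q i = trans (coeff-deriv p i)
    (trans (cong (suc i ×_) (p≈q (suc i))) (sym (coeff-deriv q i)))

-- The polynomials Ψₙ and fᵢ

module CyclotomicFactor where
  open PolynomialRing
  open Degree
  open Remainder
  open ℕ/1
  open ValueAt1
  open Derivative
  open ≡ using (refl; sym; trans; cong; cong₂)
  private module P = CommutativeRing ℚ[x]-commutativeRing
  open Ring ℚ[x]-commutativeRing
  open Geometric ℚ[x]-commutativeRing
  open RingMorphisms.IsRingHomomorphism const-isRingHomomorphism using (*-homo)

  t : ℚ[x]
  t = 1ₚ -ₚ X

  t+X≈1 : t +ₚ X ≈ₚ 1ₚ
  t+X≈1 = λ { zero → refl ; (suc zero) → refl ; (suc (suc i)) → refl }

  X*-shift : ∀ p → X *ₚ p ≈ₚ 0ℚ ∷ p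
  X*-shift p i = trans (shift-*-assoc 1ₚ p i) (∷-cong 0ℚ (*ₚ-identityˡ p) i)

  -- The Horner form, from which the degree, the value at 1 and the derivative follow by recursion
  -- on n.
  Ψ-suc : ∀ n → Ψ (suc n) ≈ₚ 1ℚ ∷ Ψ n
  Ψ-suc n i = trans (geo-suc X n i) (+ₚ-cong 1ₚ 1ₚ (X *ₚ Ψ n) (0ℚ ∷ Ψ n) (λ _ → refl) (X*-shift (Ψ n)) i)

  HasDegree-Ψ-suc : ∀ n → HasDegree (Ψ (suc n)) n
  HasDegree-Ψ-suc zero    = HasDegree-1
  HasDegree-Ψ-suc (suc n) = HasDegree-resp (λ i → sym (Ψ-suc (suc n) i)) (HasDegree-∷ (HasDegree-Ψ-suc n))

  HasDegree-Ψ : ∀ n ⦃ _ : NonTrivial n ⦄ → HasDegree (Ψ n) (n ∸ 1)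
  HasDegree-Ψ (suc n) = HasDegree-Ψ-suc n

  HasDegree-t : HasDegree t 1
  HasDegree-t = hasDegree (VanishesFrom-∷ (VanishesFrom-∷ VanishesFrom-[])) λ ()

  value-Ψ : ∀ n → value (Ψ n) ≡ fromℕ n
  value-Ψ zero    = refl
  value-Ψ (suc n) = trans (value-cong (Ψ (suc n)) (1ℚ ∷ Ψ n) (Ψ-suc n))
    (trans (value-∷ 1ℚ (Ψ n)) (trans (cong (1ℚ ℚ.+_) (value-Ψ n)) (sym (fromℕ-suc n))))

  deriv-Ψ-suc : ∀ n → deriv (Ψ (suc n)) ≈ₚ Ψ n +ₚ X *ₚ deriv (Ψ n)
  deriv-Ψ-suc n i = trans (deriv-cong (Ψ (suc n)) (1ℚ ∷ Ψ n) (Ψ-suc n) i)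
    (+ₚ-cong (Ψ n) (Ψ n) (0ℚ ∷ deriv (Ψ n)) (X *ₚ deriv (Ψ n)) (λ _ → refl) (λ i → sym (X*-shift (deriv (Ψ n)) i)) i)

  1-X^n≈tΨ : ∀ n → 1ₚ -ₚ X ^ₚ n ≈ₚ t *ₚ Ψ n
  1-X^n≈tΨ n = begin
    1ₚ -ₚ w                  ≈⟨ +ₚ-cong 1ₚ (t *ₚ Ψ n +ₚ w) (-ₚ w) (-ₚ w) (λ i → sym (geo-telescopes {t} {X} t+X≈1 n i)) (λ _ → refl) ⟩
    (t *ₚ Ψ n +ₚ w) -ₚ w     ≈⟨ +ₚ-assoc (t *ₚ Ψ n) w (-ₚ w) ⟩
    t *ₚ Ψ n +ₚ (w -ₚ w)     ≈⟨ +ₚ-cong (t *ₚ Ψ n) (t *ₚ Ψ n) (w -ₚ w) [] (λ _ → refl) (+ₚ-inverseʳ w) ⟩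
    t *ₚ Ψ n +ₚ []           ≈⟨ +ₚ-identityʳ (t *ₚ Ψ n) ⟩
    t *ₚ Ψ n                 ∎
    where
    open import Relation.Binary.Reasoning.Setoid P.setoid
    w : ℚ[x]
    w = X ^ₚ n

  module _ (n : ℕ) ⦃ n≥2 : NonTrivial n ⦄ where
    private
      instance
        n≢0 : ℕ.NonZero n
        n≢0 = nonTrivial⇒nonZero n
      g : ℚ[x]
      g = const (ℚ.- (+ 1 ℚ./ n)) *ₚ X *ₚ deriv (Ψ n)

    f≋g^ : ∀ i → f n i ≋ g ^ₚ i [mod Ψ n ]
    f≋g^ i = rem-≋ (g ^ₚ i) (Ψ n) (Ψ-nonZero n)

    f-vanishes : ∀ i → VanishesFrom (n ∸ 1) (f n i)
    f-vanishes i = rem-vanishes (g ^ₚ i) (Ψ n) (Ψ-nonZero n) (HasDegree-Ψ n)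

    -- Here n ≥ 2 enters: Ψ n has positive degree, so 1 is its own remainder.
    f₀≈1 : f n 0 ≈ₚ 1ₚ
    f₀≈1 = ≋⇒≈ (HasDegree-Ψ n) (f-vanishes 0)
      (VanishesFrom-≤ (ℕ.∸-monoˡ-≤ 1 (ℕ.nonTrivial⇒n>1 n)) (vanishes-above HasDegree-1)) (f≋g^ 0)

    t*g≋1ₚ : t *ₚ g ≋ 1ₚ [mod Ψ n ]
    t*g≋1ₚ = InverseOfT.t*g≋1 ℚ[x]-commutativeRing {t} {X} t+X≈1 (deriv ∘ Ψ) (const ∘ fromℕ)
      (λ _ → refl) (λ { zero → refl ; (suc i) → refl }) deriv-Ψ-suc
      (λ n i → cong (λ a → coeff (const a) i) (fromℕ-suc n))
      {const (+ 1 ℚ./ n)} {const (ℚ.- (+ 1 ℚ./ n))} n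
      (λ { zero → ℚ.+-inverseˡ (+ 1 ℚ./ n) ; (suc i) → refl })
      (λ i → trans (sym (*-homo (+ 1 ℚ./ n) (fromℕ n) i)) (cong (λ a → coeff (const a) i) (1/n*n≡1 n)))

    f≋t*f-suc : ∀ i → f n i ≋ t *ₚ f n (suc i) [mod Ψ n ]
    f≋t*f-suc i = ≋-trans (f≋g^ i) (≋-sym (≋-trans (≋-*-cong (≈⇒≋ {t} {t} λ _ → refl) (f≋g^ (suc i)))
      (InverseOfT.t*power ℚ[x]-commutativeRing {t} {X} t+X≈1 t*g≋1ₚ i)))

    f-recurrence : ∀ i → const (fromℕ n) *ₚ f n i ≈ₚ
                   const (fromℕ n) *ₚ (t *ₚ f n (suc i)) +ₚ const (value (f n i)) *ₚ Ψ n
    f-recurrence i = recurrence (f≋t*f-suc i)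
      where
      -- Taking the congruence as an argument keeps its quotient opaque in the computation.
      recurrence : f n i ≋ t *ₚ f n (suc i) [mod Ψ n ] →
                   const (fromℕ n) *ₚ f n i ≈ₚ const (fromℕ n) *ₚ (t *ₚ f n (suc i)) +ₚ const (value (f n i)) *ₚ Ψ n
      recurrence f≋@(modulo q f≈) = begin
        N *ₚ f n i                                           ≈⟨ *ₚ-congˡ N (f n i) (tf +ₚ q *ₚ Ψ n) f≈ ⟩
        N *ₚ (tf +ₚ q *ₚ Ψ n)                                ≈⟨ *ₚ-distribˡ N tf (q *ₚ Ψ n) ⟩
        N *ₚ tf +ₚ N *ₚ (q *ₚ Ψ n)                           ≈⟨ +ₚ-cong (N *ₚ tf) (N *ₚ tf) (N *ₚ (q *ₚ Ψ n)) (const (value (f n i)) *ₚ Ψ n) (λ _ → refl) NqΨ≈ ⟩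
        N *ₚ tf +ₚ const (value (f n i)) *ₚ Ψ n              ∎
        where
        open import Relation.Binary.Reasoning.Setoid P.setoid
        N tf : ℚ[x]
        N  = const (fromℕ n)
        tf = t *ₚ f n (suc i)
        α : ℚ
        α = coeff q 0
        -- Multiplying by t raises the bound n - 1 of f (suc i) to (n - 1) + 1, just one more than
        -- deg Ψ n; so q is a constant α.
        q₀ : VanishesFrom 1 q
        q₀ = ≋⇒quotient-vanishes {e = 1} (HasDegree-Ψ n)
          (VanishesFrom-≤ (ℕ.m≤m+n _ 1) (f-vanishes i))
          (VanishesFrom-≤ (ℕ.≤-reflexive (ℕ.+-comm 1 (n ∸ 1)))
            (VanishesFrom-* t (f n (suc i)) (vanishes-above HasDegree-t) (f-vanishes (suc i)))) f≋
        q≈α : q ≈ₚ const α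
        q≈α zero    = refl
        q≈α (suc j) = coeff≡0 q₀ (suc j) (s≤s z≤n)
        -- At 1 the factor t vanishes and Ψ n takes the value n. The factor n in the recurrence
        -- avoids writing α as a quotient.
        value-f : value (f n i) ≡ fromℕ n ℚ.* α
        value-f =
          trans (value-cong (f n i) (tf +ₚ q *ₚ Ψ n) f≈)
          (trans (value-+ tf (q *ₚ Ψ n))
          (trans (cong₂ ℚ._+_ (trans (value-* t (f n (suc i))) (ℚ.*-zeroˡ (value (f n (suc i)))))
                              (value-* q (Ψ n)))
          (trans (ℚ.+-identityˡ (value q ℚ.* value (Ψ n)))
          (trans (cong₂ ℚ._*_ (trans (value-cong q (const α) q≈α) (trans (value-∷ α []) (ℚ.+-identityʳ α)))
                              (value-Ψ n))
                 (ℚ.*-comm α (fromℕ n))))))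
        NqΨ≈ : N *ₚ (q *ₚ Ψ n) ≈ₚ const (value (f n i)) *ₚ Ψ n
        NqΨ≈ = begin
          N *ₚ (q *ₚ Ψ n)                      ≈⟨ *ₚ-assoc N q (Ψ n) ⟨
          N *ₚ q *ₚ Ψ n                        ≈⟨ *ₚ-congʳ (N *ₚ q) (N *ₚ const α) (Ψ n) (*ₚ-congˡ N q (const α) q≈α) ⟩
          N *ₚ const α *ₚ Ψ n                  ≈⟨ *ₚ-congʳ (N *ₚ const α) (const (fromℕ n ℚ.* α)) (Ψ n) (λ j → sym (*-homo (fromℕ n) α j)) ⟩
          const (fromℕ n ℚ.* α) *ₚ Ψ n         ≡⟨ cong (λ v → const v *ₚ Ψ n) value-f ⟨
          const (value (f n i)) *ₚ Ψ n         ∎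

-- Rational functions

open import Data.Nat.Base using (_+_; _*_; _≥_; _>_)

module RationalFunction where
  open PolynomialRing
  open ≡ using (refl; sym; trans; cong; cong₂)
  open ℚ⟨x⟩
  private module F = Fractions ℚ[x]-commutativeRing

  infix 4 _≐_/_
  -- `_+ᵣ_` multiplies denominators without cancelling, so those of long sums become unwieldy.
  -- Relating every summand to one chosen denominator d keeps the numerators additive.
  record _≐_/_ (r : ℚ⟨x⟩) (e d : ℚ[x]) : Set where
    constructor cross
    field equality : num r *ₚ d ≈ₚ e *ₚ den r
  open _≐_/_

  ≐-cong : ∀ {r e e′ d d′} → e ≈ₚ e′ → d ≈ₚ d′ → r ≐ e / d → r ≐ e′ / d′
  ≐-cong {r} {e} {e′} {d} {d′} e≈ d≈ (cross eq) = cross λ i →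
    trans (*ₚ-congˡ (num r) d′ d (λ i → sym (d≈ i)) i) (trans (eq i) (*ₚ-congʳ e e′ (den r) e≈ i))

  ≐-+ : ∀ {r s e e′ d} → r ≐ e / d → s ≐ e′ / d → r +ᵣ s ≐ e +ₚ e′ / d
  ≐-+ {r} {s} {e} {e′} {d} (cross r≐) (cross s≐) =
    cross (F.+-fraction (num r) (den r) e (num s) (den s) e′ d r≐ s≐)

  ≐-* : ∀ {r s e e′ d d′} → r ≐ e / d → s ≐ e′ / d′ → r *ᵣ s ≐ e *ₚ e′ / d *ₚ d′
  ≐-* {r} {s} {e} {e′} {d} {d′} (cross r≐) (cross s≐) =
    cross (F.*-fraction (num r) (den r) e d (num s) (den s) e′ d′ r≐ s≐)

  ≐-sum : ∀ {k d} (r : Vector ℚ⟨x⟩ k) (e : Vector ℚ[x] k) → (∀ j → r j ≐ e j / d) → sumᵣ r ≐ sumₚ e / d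
  ≐-sum {zero}  r e r≐ = cross λ _ → refl
  ≐-sum {suc k} r e r≐ = ≐-+ (r≐ zero) (≐-sum (r ∘ suc) (e ∘ suc) (r≐ ∘ suc))

  ≐-product : ∀ {k} (r : Vector ℚ⟨x⟩ k) (e d : Vector ℚ[x] k) → (∀ j → r j ≐ e j / d j) →
              productᵣ r ≐ Sumsₚ.product e / Sumsₚ.product d
  ≐-product {zero}  r e d r≐ = cross λ _ → refl
  ≐-product {suc k} r e d r≐ = ≐-* (r≐ zero) (≐-product (r ∘ suc) (e ∘ suc) (d ∘ suc) (r≐ ∘ suc))

  *ₚ-cancelʳ : ∀ p q d → NonZeroₚ d → p *ₚ d ≈ₚ q *ₚ d → p ≈ₚ q
  *ₚ-cancelʳ p q d (nonZeroₚ d≉0) pd≈qd = λ i → begin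
    coeff p i                                 ≡⟨ +ₚ-identityʳ p i ⟨
    coeff (p +ₚ []) i                         ≡⟨ +ₚ-cong p p (-ₚ q +ₚ q) [] (λ _ → refl) (+ₚ-inverseˡ q) i ⟨
    coeff (p +ₚ (-ₚ q +ₚ q)) i                ≡⟨ +ₚ-assoc p (-ₚ q) q i ⟨
    coeff (p -ₚ q +ₚ q) i                     ≡⟨ +ₚ-cong (p -ₚ q) [] q q p-q≈0 (λ _ → refl) i ⟩
    coeff q i                                 ∎
    where
    open ≡.≡-Reasoning
    [p-q]d≈0 : (p -ₚ q) *ₚ d ≈ₚ 0ₚ
    [p-q]d≈0 i = begin
      coeff ((p -ₚ q) *ₚ d) i            ≡⟨ *ₚ-distribʳ d p (-ₚ q) i ⟩
      coeff (p *ₚ d +ₚ -ₚ q *ₚ d) i      ≡⟨ +ₚ-cong (p *ₚ d) (q *ₚ d) (-ₚ q *ₚ d) (-ₚ q *ₚ d) pd≈qd (λ _ → refl) i ⟩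
      coeff (q *ₚ d +ₚ -ₚ q *ₚ d) i      ≡⟨ *ₚ-distribʳ d q (-ₚ q) i ⟨
      coeff ((q -ₚ q) *ₚ d) i            ≡⟨ *ₚ-congʳ (q -ₚ q) [] d (+ₚ-inverseʳ q) i ⟩
      0ℚ                                 ∎
    p-q≈0 : p -ₚ q ≈ₚ 0ₚ
    p-q≈0 = [ id , (λ d≈0 → contradiction d≈0 d≉0) ]′ (*ₚ-cancel-0 (p -ₚ q) d [p-q]d≈0)

  ≐-unique : ∀ {r s e d} → NonZeroₚ d → r ≐ e / d → s ≐ e / d → r ≈ᵣ s
  ≐-unique {r} {s} {e} {d} d≉0 (cross r≐) (cross s≐) =
    *ₚ-cancelʳ (num r *ₚ den s) (num s *ₚ den r) d d≉0
      (F.cross-multiply (num r) (den r) (num s) (den s) e d r≐ s≐)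

-- Turns the integer relation into the successor form on which `geo-suc` acts.
An≡1+Bn : ∀ a n b m → (+ (a * n)) ℤ.- (+ (b * m)) ≡ 1ℤ → a * n ≡ suc (b * m)
An≡1+Bn a n b m eq = ℤ.+-injective (begin
  + (a * n)                                ≡⟨ ℤ.+-identityʳ _ ⟨
  + (a * n) ℤ.+ + 0                        ≡⟨ ≡.cong (ℤ._+_ (+ (a * n))) (ℤ.+-inverseˡ (+ (b * m))) ⟨
  + (a * n) ℤ.+ (ℤ.- (+ (b * m)) ℤ.+ + (b * m)) ≡⟨ ℤ.+-assoc (+ (a * n)) (ℤ.- (+ (b * m))) (+ (b * m)) ⟨
  + (a * n) ℤ.- + (b * m) ℤ.+ + (b * m)    ≡⟨ ≡.cong (ℤ._+ (+ (b * m))) eq ⟩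
  1ℤ ℤ.+ + (b * m)                         ∎)
  where open ≡.≡-Reasoning

-- The decomposition over ℚ(x)

module Decomposition
  {k} (m : ℕ) (n : Fin (suc k) → ℕ) ⦃ n≥2 : ∀ {j} → NonTrivial (n j) ⦄ (a : ℕ → ℚ)
  (A B : Fin (suc k) → Fin (suc k) → ℕ)
  (An≡1+Bn : ∀ {i j} → i ≢ j → A j i * n i ≡ suc (B j i * n j))
  (A≡1 : ∀ j → A j j ≡ 1) where

  open PolynomialRing
  open Degree
  open Remainder
  open ℕ/1
  open ValueAt1
  open CyclotomicFactor
  open RationalFunction
  open ≡ using (refl; sym; trans; cong; cong₂; subst)
  open Sumsₚ using (product)
  open Ring ℚ[x]-commutativeRing
  open Truncation ℚ.+-*-commutativeRing ℚ[x]-commutativeRing const-isRingHomomorphism t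
  open PartialFractions ℚ.+-*-commutativeRing ℚ[x]-commutativeRing const-isRingHomomorphism t X
  private
    module P = CommutativeRing ℚ[x]-commutativeRing
    module * = Algebra.Properties.CommutativeMonoid.Sum P.*-commutativeMonoid
    module F = Fractions ℚ[x]-commutativeRing
    instance
      nⱼ≢0 : ∀ {j} → ℕ.NonZero (n j)
      nⱼ≢0 {j} = nonTrivial⇒nonZero (n j)
      product≢0 : ℕ.NonZero (Sumsℕ.product n)
      product≢0 = product-nonZero n λ j → nonTrivial⇒nonZero (n j)

  -- Kept with `∸ 1` to agree by definition with `h` and with the range of the polar sum; `1+N≡m+k`
  -- converts where t^(m+k) occurs.
  N : ℕ
  N = m + suc k ∸ 1

  1+N≡m+k : suc N ≡ m + suc k
  1+N≡m+k rewrite ℕ.+-suc m k = refl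

  p P C D Q : ℚ[x]
  p = truncate (m + suc k) a
  P = product (Ψ ∘ n)
  C = truncate N (c n a)
  D = t ^ₚ (m + suc k) *ₚ P

  Pᵣ G H : Vector ℚ[x] (suc k)
  Pᵣ j = product (removeAt (Ψ ∘ n) j)
  G j = Sumsₚ.sumBelow (A j) λ is → X ^ₚ (Sumsℕ.sum (λ l → is l * n l) ℕ.% n j)
  H = h m n p A

  Q = C *ₚ P +ₚ t ^ₚ N *ₚ sumₚ (λ j → H j *ₚ Pᵣ j)

  Q≋p : Q ≋ p [mod t ^ₚ N *ₚ P ]
  Q≋p = numerator-≋ n N A B An≡1+Bn A≡1
    (fromℕ ∘ n) (λ l → + 1 ℚ./ n l) (λ l → 1/n*n≡1 (n l))
    (λ l → f (n l) N) (λ l i → value (f (n l) i))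
    (λ l → expansion {Ψ (n l)} {fromℕ (n l)} (f (n l)) (λ i → value (f (n l) i)) (f₀≈1 (n l)) (f-recurrence (n l)) N)
    a (+ 1 ℚ./ Sumsℕ.product n)
    (trans (cong ((+ 1 ℚ./ Sumsℕ.product n) ℚ.*_) (sym (fromℕ-product n))) (1/n*n≡1 (Sumsℕ.product n)))
    (c n a) (λ j → refl)
    -- p has one term more than `truncate N a`, namely a_N t^N, a multiple of the modulus.
    p (modulo (const (a N)) (subst (λ M → truncate M a ≈ₚ truncate N a +ₚ const (a N) *ₚ t ^ₚ N) 1+N≡m+k (truncate-last N a)))
    H (λ j → ≋-trans (rem-≋ (p *ₚ f (n j) N *ₚ G j) (Ψ (n j)) (Ψ-nonZero (n j)))
      (≋-*-cong (≈⇒≋ {p *ₚ f (n j) N} {p *ₚ f (n j) N} λ _ → refl) (Geometric.sumBelow-x^ ℚ[x]-commutativeRing {t} {X} t+X≈1 n (A j) (n j))))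

  d : ℕ
  d = Sumsℕ.sum (λ l → n l ∸ 1)

  HasDegree-P : HasDegree P d
  HasDegree-P = HasDegree-product (Ψ ∘ n) (λ l → n l ∸ 1) (λ l → HasDegree-Ψ (n l))

  -- Since p may have degree N, it lies below deg (t^N P) = N + d only if d is positive; the factor
  -- for `n zero` ensures this.
  1≤d : 1 ℕ.≤ d
  1≤d = ℕ.≤-trans (ℕ.∸-monoˡ-≤ 1 (ℕ.nonTrivial⇒n>1 (n zero))) (ℕ.m≤m+n (n zero ∸ 1) _)

  P≈ΨPᵣ : ∀ j → P ≈ₚ Ψ (n j) *ₚ Pᵣ j
  P≈ΨPᵣ j = *.sum-remove {i = j} (Ψ ∘ n)

  truncate-vanishes : ∀ M u → VanishesFrom M (truncate M u)
  truncate-vanishes M u = VanishesFrom-sum {k = M} _ λ i →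
    VanishesFrom-≤ (Fin.toℕ<n i)
      (VanishesFrom-* {0} (const (u (toℕ i))) (t ^ₚ toℕ i) (VanishesFrom-∷ VanishesFrom-[])
        (vanishes-above (HasDegree-^ HasDegree-t (toℕ i))))

  H-vanishes : ∀ j → VanishesFrom (n j ∸ 1) (H j)
  H-vanishes j = rem-vanishes (p *ₚ f (n j) N *ₚ G j) (Ψ (n j)) (Ψ-nonZero (n j)) (HasDegree-Ψ (n j))

  -- A remainder modulo Ψ (n j) has smaller degree than Ψ (n j), the one factor of P that `Pᵣ j`
  -- lacks.
  HPᵣ-vanishes : ∀ j → VanishesFrom d (H j *ₚ Pᵣ j)
  HPᵣ-vanishes j = VanishesFrom-resp (*ₚ-comm (Pᵣ j) (H j))
    (VanishesFrom-≤ (ℕ.≤-reflexive e+nⱼ-1≡d)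
      (VanishesFrom-* (Pᵣ j) (H j) (vanishes-above HasDegree-Pᵣ) (H-vanishes j)))
    where
    e : ℕ
    e = Sumsℕ.sum (removeAt (λ l → n l ∸ 1) j)
    HasDegree-Pᵣ : HasDegree (Pᵣ j) e
    HasDegree-Pᵣ = HasDegree-product (removeAt (Ψ ∘ n) j) (removeAt (λ l → n l ∸ 1) j) λ l → HasDegree-Ψ _
    e+nⱼ-1≡d : e + (n j ∸ 1) ≡ d
    -- Both numbers are degrees of P = Ψ (n j) Pᵣ j, so uniqueness of the degree spares a
    -- computation with sums.
    e+nⱼ-1≡d = trans (ℕ.+-comm e (n j ∸ 1)) (HasDegree-unique
      (HasDegree-* (HasDegree-Ψ (n j)) HasDegree-Pᵣ)
      (HasDegree-resp (P≈ΨPᵣ j) HasDegree-P))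

  Q≈p : Q ≈ₚ p
  Q≈p = ≋⇒≈ (HasDegree-* (HasDegree-^ HasDegree-t N) HasDegree-P)
    (VanishesFrom-+
      (VanishesFrom-resp (*ₚ-comm P C)
        (VanishesFrom-≤ (ℕ.≤-reflexive (ℕ.+-comm d N))
          (VanishesFrom-* P C (vanishes-above HasDegree-P) (truncate-vanishes N (c n a)))))
      (VanishesFrom-* (t ^ₚ N) _ (vanishes-above (HasDegree-^ HasDegree-t N)) (VanishesFrom-sum _ HPᵣ-vanishes)))
    (VanishesFrom-≤ (ℕ.≤-trans (ℕ.≤-reflexive (trans (sym 1+N≡m+k) (ℕ.+-comm 1 N))) (ℕ.+-monoʳ-≤ N 1≤d))
      (truncate-vanishes (m + suc k) a))
    Q≋p

  HasDegree-D : HasDegree D (m + suc k + d)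
  HasDegree-D = HasDegree-* (HasDegree-^ HasDegree-t (m + suc k)) HasDegree-P

  private
    factor cyclotomicPart : Vector ℚ⟨x⟩ (suc k)
    factor j = 1ₚ /ₚ (1ₚ -ₚ X ^ₚ n j) ∵ 1-X^-nonZero (n j)
    cyclotomicPart j = H j /ₚ (1ₚ -ₚ X ^ₚ n j) ∵ 1-X^-nonZero (n j)
    polarPart : Vector ℚ⟨x⟩ N
    polarPart j = const (c n a (toℕ j)) /ₚ t ^ₚ (m + suc k ∸ toℕ j) ∵ [1-X]^-nonZero (m + suc k ∸ toℕ j)
    lhs : ℚ⟨x⟩
    lhs = (p /ₚ t ^ₚ m ∵ [1-X]^-nonZero m) *ᵣ productᵣ factor

  lhs≐ : lhs ≐ p / D
  lhs≐ = ≐-cong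
    -- `≐-product` leaves a product of ones in the numerator.
    (λ i → trans (*ₚ-congˡ p (product {suc k} λ _ → 1ₚ) 1ₚ (*.sum-replicate-zero (suc k)) i) (*ₚ-identityʳ p i))
    (F.common-denominator t m (Ψ ∘ n))
    (≐-* {p /ₚ t ^ₚ m ∵ [1-X]^-nonZero m} {e = p} {d = t ^ₚ m} (cross λ _ → refl)
      (≐-product factor (λ _ → 1ₚ) (λ j → t *ₚ Ψ (n j)) λ j →
        cross λ i → *ₚ-congˡ 1ₚ (t *ₚ Ψ (n j)) (1ₚ -ₚ X ^ₚ n j) (λ i → sym (1-X^n≈tΨ (n j) i)) i))

  sum-polarPart≐ : sumᵣ polarPart ≐ C *ₚ P / D
  sum-polarPart≐ = ≐-cong {d = D} (λ i → sym (*-distribʳ-sum {N} P (λ j → const (c n a (toℕ j)) *ₚ t ^ₚ toℕ j) i)) (λ _ → refl)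
    (≐-sum polarPart (λ j → const (c n a (toℕ j)) *ₚ t ^ₚ toℕ j *ₚ P) λ j → cross
      (F.pole-numerator (const (c n a (toℕ j))) t P {toℕ j} {m + suc k}
        -- j < N < m + k, so the `∸` in the pole order is a true difference.
        (ℕ.≤-trans (ℕ.<⇒≤ (Fin.toℕ<n j)) (ℕ.≤-trans (ℕ.n≤1+n N) (ℕ.≤-reflexive 1+N≡m+k)))))
    where open Algebra.Properties.Semiring.Sum P.semiring using (*-distribʳ-sum)

  sum-cyclotomicPart≐ : sumᵣ cyclotomicPart ≐ t ^ₚ N *ₚ sumₚ (λ j → H j *ₚ Pᵣ j) / D
  sum-cyclotomicPart≐ = ≐-cong
    (λ i → sym (*-distribˡ-sum (t ^ₚ N) (λ j → H j *ₚ Pᵣ j) i))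
    -- `cyclotomic-numerator` yields the denominator t t^N P, which is t^(suc N) P by unfolding.
    (λ i → cong (λ M → coeff (t ^ₚ M *ₚ P) i) 1+N≡m+k)
    (≐-sum cyclotomicPart (λ j → t ^ₚ N *ₚ (H j *ₚ Pᵣ j)) λ j → cross
      (F.cyclotomic-numerator (H j) t (t ^ₚ N) P (Ψ (n j)) (Pᵣ j) {1ₚ -ₚ X ^ₚ n j} (1-X^n≈tΨ (n j)) (P≈ΨPᵣ j)))
    where open Algebra.Properties.Semiring.Sum P.semiring using (*-distribˡ-sum)

  decomposition : lhs ≈ᵣ sumᵣ polarPart +ᵣ sumᵣ cyclotomicPart
  decomposition = ≐-unique {lhs} {sumᵣ polarPart +ᵣ sumᵣ cyclotomicPart} (HasDegree⇒NonZero HasDegree-D) lhs≐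
    (≐-cong Q≈p (λ _ → refl) (≐-+ sum-polarPart≐ sum-cyclotomicPart≐))

theorem4p11 : (k m : ℕ) → k ≥ 1 →
    (n : Fin k → ℕ) ⦃ n≥2 : ∀ {j} → NonTrivial (n j) ⦄ →
    (∀ i j → i ≢ j → Coprime (n i) (n j)) →
    (a : ℕ → ℚ) →
    let p = sumₚ {m + k} λ i → const (a (toℕ i)) *ₚ (1ₚ -ₚ X) ^ₚ toℕ i in
    (∀ j → NoCommonRoot p (1ₚ -ₚ X ^ₚ n j)) →
    (A B : Fin k → Fin k → ℕ) →
    (∀ i j → i ≢ j → A j i > 0) →
    (∀ i j → i ≢ j → B j i > 0) →
    (∀ i j → i ≢ j → (+ (A j i * n i)) ℤ.- (+ (B j i * n j)) ≡ 1ℤ) →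
    (∀ j → A j j ≡ 1) →
    (p /ₚ (1ₚ -ₚ X) ^ₚ m ∵ [1-X]^-nonZero m) *ᵣ productᵣ (λ j → 1ₚ /ₚ (1ₚ -ₚ X ^ₚ n j) ∵ 1-X^-nonZero (n j))
    ≈ᵣ
    sumᵣ {m + k ∸ 1} (λ j → const (c n a (toℕ j)) /ₚ (1ₚ -ₚ X) ^ₚ (m + k ∸ toℕ j) ∵ [1-X]^-nonZero (m + k ∸ toℕ j))
    +ᵣ sumᵣ (λ j → h m n p A j /ₚ (1ₚ -ₚ X ^ₚ n j) ∵ 1-X^-nonZero (n j))
-- k ≥ 1 excludes the clause for zero; the form `suc k` is what `removeAt` and `1≤d` rely on.
theorem4p11 (suc k) m _ n _ a _ A B _ _ An-Bn≡1 A≡1 =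
  Decomposition.decomposition m n a A B
    (λ {i} {j} i≢j → An≡1+Bn (A j i) (n i) (B j i) (n j) (An-Bn≡1 i j i≢j)) A≡1
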